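{- There exist an effective programming system (eps) $\psi$ and a computably enumerable equivalence relation (ceer) $R\subseteq\mathrm{Equiv}(\psi)$ satisfying both (a) and (b) below. (a) For each translation function $t$ into $\psi$, $R$ weakly ties $t$ into $\psi$. (b) For each ceer $R'$, there exists a translation function $t$ into $\psi$ such that $R'$ does not strongly tie $t$ into $\psi$.
   Context: $\mathbb{N}=\{0,1,2,\dots\}$. Partial functions map $\mathbb{N}$ to $\mathbb{N}$ unless stated otherwise; equality of partial functions means same domain and same values. An effective programming system (eps) is a partial computable function $\psi:(p,x)\mapsto\psi_p(x)$ from $\mathbb{N}^2$ to $\mathbb{N}$ such that for each partial computable function $\zeta$ from $\mathbb{N}$ to $\mathbb{N}$ there exists $p$ with $\psi_p=\zeta$. Here $\psi_p$ denotes the partial function $x\mapsto\psi_p(x)$. For epses $\theta$ and $\psi$, $\theta\le\psi$ iff there exists a (total) computable function $t:\mathbb{N}\to\mathbb{N}$ such that $\theta_p=\psi_{t(p)}$ for each $p$; such a $t$ is said to witness $\theta\le\psi$. A function $t:\mathbb{N}\to\mathbb{N}$ is a translation function into an eps $\psi$ iff there exists an eps $\theta$ such that $t$ witnesses $\theta\le\psi$ (equivalently, $t$ is computable and $(p,x)\mapsto\psi_{t(p)}(x)$ is an eps). The program equivalence relation of an eps $\psi$ is $\mathrm{Equiv}(\psi)=\{(p,q)\in\mathbb{N}^2 : \psi_p=\psi_q\}$. A ceer is an equivalence relation on $\mathbb{N}$ that is computably enumerable as a set of pairs. Let $\psi$ be an eps, $t$ a translation function into $\psi$, and $R$ an equivalence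 relation on $\mathbb{N}$. $R$ strongly ties $t$ into $\psi$ iff (i) $R\subseteq\mathrm{Equiv}(\psi)$ and (ii) the range of $t$ intersects each of $R$'s equivalence classes. $R$ weakly ties $t$ into $\psi$ iff (i) $R\subseteq\mathrm{Equiv}(\psi)$ and (ii*) the range of $t$ intersects all but finitely many of $R$'s equivalence classes. -}

module Defs where

open import Data.Fin.Base using (Fin)
open import Data.List.Base using (List)
open import Data.List.Relation.Unary.Any using (Any)
open import Data.Nat.Base using (ℕ; zero; suc; _<_)
open import Data.Nat.Properties using (<-cmp)
open import Data.Product.Base using (Σ-syntax; ∃-syntax; _×_; _,_)
open import Data.Unit.Base using (⊤; tt)
open import Data.Vec.Base using (Vec; []; _∷_; head; lookup)
open import Function.Bundles using (_⇔_)
open import Level using (0ℓ)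
open import Relation.Binary.Core using (Rel; _⇒_)
open import Relation.Binary.Definitions using (tri<; tri≈; tri>)
open import Relation.Binary.PropositionalEquality using (_≡_; refl; sym; trans)
open import Relation.Binary.Structures using (IsEquivalence)
open import Relation.Nullary.Negation.Core using (¬_)
open import Relation.Unary using (Pred; _≬_)

private
  variable
    k m : ℕ

------------------------------------------------------------------------
-- Partial functions

-- A partial function is a single-valued graph; a domain need not be
-- decidable.
infix 1 _⇀_

record _⇀_ (A B : Set) : Set₁ where
  field
    graph      : A → B → Set
    functional : ∀ {x y z} → graph x y → graph x z → y ≡ z

open _⇀_ public

infix 4 _≐_

-- For single-valued graphs, having the same graph is having the same
-- domain and the same values.
_≐_ : {A B : Set} → A ⇀ B → A ⇀ B → Set
f ≐ g = ∀ x y → graph f x y ⇔ graph g x y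

dom : {A B : Set} → A ⇀ B → Pred A 0ℓ
dom f x = ∃[ y ] graph f x y

section : (Vec ℕ (suc k) ⇀ ℕ) → ℕ → (Vec ℕ k ⇀ ℕ)
section f p = record
  { graph      = λ xs → graph f (p ∷ xs)
  ; functional = functional f
  }

total : (ℕ → ℕ) → (Vec ℕ 1 ⇀ ℕ)
total t = record
  { graph      = λ xs y → t (head xs) ≡ y
  ; functional = λ p q → trans (sym p) q
  }

------------------------------------------------------------------------
-- Kleene's μ-recursive functions

data Rec : ℕ → Set where
  zero : Rec k
  suc  : Rec 1
  proj : Fin k → Rec k
  comp : Rec m → Vec (Rec k) m → Rec k
  prec : Rec k → Rec (suc (suc k)) → Rec (suc k)
  μ    : Rec (suc k) → Rec k

mutual
  Eval : Rec k → Vec ℕ k → ℕ → Set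
  Eval zero       xs           y = y ≡ 0
  Eval suc        (x ∷ [])     y = y ≡ suc x
  Eval (proj i)   xs           y = y ≡ lookup xs i
  Eval (comp f gs) xs          y = ∃[ zs ] EvalAll gs xs zs × Eval f zs y
  Eval (prec f g) (zero ∷ xs)  y = Eval f xs y
  Eval (prec f g) (suc n ∷ xs) y =
    ∃[ z ] Eval (prec f g) (n ∷ xs) z × Eval g (n ∷ z ∷ xs) y
  Eval (μ f)      xs           y =
    Eval f (y ∷ xs) 0 × (∀ i → i < y → ∃[ z ] Eval f (i ∷ xs) (suc z))

  EvalAll : Vec (Rec k) m → Vec ℕ k → Vec ℕ m → Set
  EvalAll []       xs []       = ⊤
  EvalAll (g ∷ gs) xs (z ∷ zs) = Eval g xs z × EvalAll gs xs zs

mutual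
  Eval-functional : (c : Rec k) (xs : Vec ℕ k) {y z : ℕ} →
                    Eval c xs y → Eval c xs z → y ≡ z
  Eval-functional zero        xs       refl refl = refl
  Eval-functional suc         (x ∷ []) refl refl = refl
  Eval-functional (proj i)    xs       refl refl = refl
  Eval-functional (comp f gs) xs (us , p , q) (vs , p′ , q′)
    with refl ← EvalAll-functional gs xs us vs p p′ =
    Eval-functional f us q q′
  Eval-functional (prec f g) (zero ∷ xs) p q = Eval-functional f xs p q
  Eval-functional (prec f g) (suc n ∷ xs) (u , p , q) (v , p′ , q′)
    with refl ← Eval-functional (prec f g) (n ∷ xs) p p′ =
    Eval-functional g (n ∷ u ∷ xs) q q′
  Eval-functional (μ f) xs {y} {z} (p , below-y) (q , below-z)
    with <-cmp y z
  ... | tri≈ _ y≡z _ = y≡z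
  ... | tri< y<z _ _ with _ , r ← below-z y y<z
                     with () ← Eval-functional f (y ∷ xs) p r
  ... | tri> _ _ z<y with _ , r ← below-y z z<y
                     with () ← Eval-functional f (z ∷ xs) q r

  EvalAll-functional : (gs : Vec (Rec k) m) (xs : Vec ℕ k) (us vs : Vec ℕ m) →
                       EvalAll gs xs us → EvalAll gs xs vs → us ≡ vs
  EvalAll-functional []       xs []       []       _       _         = refl
  EvalAll-functional (g ∷ gs) xs (u ∷ us) (v ∷ vs) (p , q) (p′ , q′)
    with refl ← Eval-functional g xs p p′
       | refl ← EvalAll-functional gs xs us vs q q′ = refl

⟦_⟧ : Rec k → (Vec ℕ k ⇀ ℕ)
⟦ c ⟧ = record { graph = Eval c ; functional = Eval-functional c _ }

PartialComputable : (Vec ℕ k ⇀ ℕ) → Set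
PartialComputable {k} f = Σ[ c ∈ Rec k ] f ≐ ⟦ c ⟧

Computable : (ℕ → ℕ) → Set
Computable t = PartialComputable (total t)

-- A relation is c.e. when, as a set of pairs, it is the domain of a
-- partial computable function.
IsCE : Rel ℕ 0ℓ → Set₁
IsCE R = Σ[ f ∈ (Vec ℕ 2 ⇀ ℕ) ]
  PartialComputable f × (∀ x y → R x y ⇔ dom f (x ∷ y ∷ []))

record IsCeer (R : Rel ℕ 0ℓ) : Set₁ where
  field
    isEquivalence : IsEquivalence R
    isCE          : IsCE R

------------------------------------------------------------------------
-- Effective programming systems

record EPS : Set₁ where
  field
    function   : Vec ℕ 2 ⇀ ℕ
    computable : PartialComputable function
    universal  : (ζ : Vec ℕ 1 ⇀ ℕ) → PartialComputable ζ →
                 ∃[ p ] section function p ≐ ζ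

  program : ℕ → (Vec ℕ 1 ⇀ ℕ)
  program = section function

open EPS public using (program)

_Witnesses_≤_ : (ℕ → ℕ) → EPS → EPS → Set
t Witnesses θ ≤ ψ = Computable t × (∀ p → program θ p ≐ program ψ (t p))

_IsTranslationInto_ : (ℕ → ℕ) → EPS → Set₁
t IsTranslationInto ψ = Σ[ θ ∈ EPS ] t Witnesses θ ≤ ψ

Equiv : EPS → Rel ℕ 0ℓ
Equiv ψ p q = program ψ p ≐ program ψ q

range : (ℕ → ℕ) → Pred ℕ 0ℓ
range t y = ∃[ n ] t n ≡ y

-- In the next two definitions R is meant to be an equivalence relation,
-- so that R x is the equivalence class of x.
StronglyTies : Rel ℕ 0ℓ → (ℕ → ℕ) → EPS → Set
StronglyTies R t ψ = R ⇒ Equiv ψ × (∀ x → range t ≬ R x)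

-- The list xs represents the finitely many exceptional classes.
WeaklyTies : Rel ℕ 0ℓ → (ℕ → ℕ) → EPS → Set
WeaklyTies R t ψ =
  R ⇒ Equiv ψ ×
  Σ[ xs ∈ List ℕ ] (∀ x → ¬ (range t ≬ R x) → Any (R x) xs)

{-# OPTIONS --safe #-}
-- ψ is a modified Friedberg numbering.  The functions with domain
-- {0, …, 2n} are set apart; all other partial computable functions have a
-- numbering χ, and a worker (j , s) follows χ j as long as s looks like a
-- length below which χ j differs from every χ k with k < j.  For the least
-- index j of a function exactly one worker survives; every other worker
-- ends up with a function on some {0, …, 2n} that it then knows completely.
-- R identifies two such finished indices when their functions agree, which
-- is decidable.
--
-- In addition, for each x there are 2^x + 1 tokens, whose functions are
-- kept equal exactly as long as they lie in the same of the first x ranges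
-- of φ 0, φ 1, ….  They can be separated later because their domains may
-- still grow.  A translation function t = φ e must meet every class of ψ;
-- once x > e, meeting one of several equal tokens means meeting all of
-- them, so only tokens with x ≤ e are missed.  On the other hand two tokens
-- of each group are equal by the pigeonhole principle, but not R-related.
-- If a ceer R' ⊆ Equiv ψ identifies no two tokens of some group, skip one
-- of a pair of equal tokens; if it identifies two tokens in each group,
-- such pairs can be found effectively, and skipping one of each pair would
-- give a translation function that misses infinitely many classes of R.
module Submission where

open import Defs
open import Axiom.ExcludedMiddle using (ExcludedMiddle)
open import Data.Nat.Base using (ℕ)
open import Data.Product.Base using (Σ-syntax; _×_)
open import Level using (0ℓ)
open import Relation.Binary.Core using (Rel; _⇒_)
open import Relation.Nullary.Negation.Core using (¬_)

open import Data.Empty using (⊥; ⊥-elim)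
open import Data.Fin.Base using (Fin; zero; suc; toℕ; fromℕ<)
open import Data.Fin.Patterns using (0F; 1F; 2F; 3F; 4F)
open import Data.Fin.Properties using (pigeonhole; toℕ<n; fromℕ<-injective)
import Data.List.Base as List
open import Data.List.Base using (List; _∷_; concatMap; upTo; foldr)
open import Data.List.Membership.Propositional using (_∈_)
open import Data.List.Membership.Propositional.Properties using (∈-concatMap⁺; ∈-map⁺; ∈-upTo⁺)
import Data.List.Relation.Unary.Any as Any
open import Data.List.Relation.Unary.Any using (here; there)
open import Data.Nat.Base hiding (ℕ; parity)
open import Data.Nat.Properties
open import Data.Product.Base using (∃-syntax; _,_; proj₁; proj₂)
open import Data.Sum.Base using (_⊎_; inj₁; inj₂)
open import Data.Unit.Base using (tt)
open import Data.Vec.Base using (Vec; []; _∷_; lookup; map; allFin)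
open import Data.Vec.Properties using (map-lookup-allFin)
open import Function.Base using (_∘_; id; case_of_)
open import Function.Bundles using (_⇔_; mk⇔; Equivalence)
open import Function.Construct.Composition using (_⇔-∘_)
open import Function.Construct.Symmetry using (⇔-sym)
open import Relation.Binary.Definitions using (tri<; tri≈; tri>)
open import Relation.Binary.PropositionalEquality
open import Relation.Binary.Structures using (IsEquivalence)
open import Relation.Nullary using (yes; no; contradiction)
open import Relation.Unary using (_≬_)

-- The obstacle is that `R` must be enumerable and yet nearly all of `Equiv ψ`: only equalities
-- between tokens of one group may be left out. So indices of different kinds must never share a
-- function unless both are finished. This is why `χ` leaves out the domains {0, ..., 2n}: a
-- surviving worker can then equal neither a finished index nor a token. It is also why a token of
-- group x outputs x + 1: this value reveals the group and is never 0, whereas a dead worker takes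
-- the value 0 at the end of its domain. The functions on some {0, ..., 2n} that belong to no token
-- need indices too. Since final positions of tokens are not computable, such an index has to carry
-- a certificate that can be checked at a single stage. Hence moving tokens only take fresh
-- positions: a position that is vacant once the stage has reached it stays vacant. The number 2^x +
-- 1 exceeds by one the number of subsets of the first x ranges. A group is rearranged only finitely
-- often, because a token never leaves a range that it has entered.

private
  variable
    k m n : ℕ

-- Total computable functions

Nary : ℕ → Set
Nary zero    = ℕ
Nary (suc n) = ℕ → Nary n

infixl 5 _$$_

_$$_ : Nary n → Vec ℕ n → ℕ
f $$ []       = f
f $$ (x ∷ xs) = f x $$ xs

curryᵛ : (Vec ℕ n → ℕ) → Nary n
curryᵛ {zero}  f = f []
curryᵛ {suc n} f = λ x → curryᵛ (f ∘ (x ∷_))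

curryᵛ-$$ : (f : Vec ℕ n → ℕ) (xs : Vec ℕ n) → (curryᵛ f $$ xs) ≡ f xs
curryᵛ-$$ f []       = refl
curryᵛ-$$ f (x ∷ xs) = curryᵛ-$$ (f ∘ (x ∷_)) xs

record Total (n : ℕ) (f : Nary n) : Set where
  constructor computes
  field
    code    : Rec n
    correct : ∀ xs → Eval code xs (f $$ xs)

open Total

infix 8 #_
infixr 4 _·_

-- Substitution into total computable functions. Most functions below obtain their code from a term
-- whose denotation agrees with them by `refl`.
data Term (n : ℕ) : Set where
  #_  : Fin n → Term n
  lit : ℕ → Term n
  _·_ : {f : Nary m} → Total m f → Vec (Term n) m → Term n

mutual
  ⟪_⟫ : Term n → Vec ℕ n → ℕ
  ⟪ # i ⟫             xs = lookup xs i
  ⟪ lit v ⟫           xs = v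
  ⟪ _·_ {f = f} _ ts ⟫ xs = f $$ ⟪ ts ⟫* xs

  ⟪_⟫* : Vec (Term n) m → Vec ℕ n → Vec ℕ m
  ⟪ [] ⟫*     xs = []
  ⟪ t ∷ ts ⟫* xs = ⟪ t ⟫ xs ∷ ⟪ ts ⟫* xs

numeral : ℕ → Rec n
numeral zero    = zero
numeral (suc v) = comp suc (numeral v ∷ [])

mutual
  compile : Term n → Rec n
  compile (# i)    = proj i
  compile (lit v)  = numeral v
  compile (f · ts) = comp (code f) (compile* ts)

  compile* : Vec (Term n) m → Vec (Rec n) m
  compile* []       = []
  compile* (t ∷ ts) = compile t ∷ compile* ts

numeral-correct : ∀ v (xs : Vec ℕ n) → Eval (numeral v) xs v
numeral-correct zero    xs = refl
numeral-correct (suc v) xs = v ∷ [] , (numeral-correct v xs , tt) , refl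

mutual
  compile-correct : (t : Term n) (xs : Vec ℕ n) → Eval (compile t) xs (⟪ t ⟫ xs)
  compile-correct (# i)    xs = refl
  compile-correct (lit v)  xs = numeral-correct v xs
  compile-correct (f · ts) xs =
    ⟪ ts ⟫* xs , compile*-correct ts xs , correct f (⟪ ts ⟫* xs)

  compile*-correct : (ts : Vec (Term n) m) (xs : Vec ℕ n) →
                     EvalAll (compile* ts) xs (⟪ ts ⟫* xs)
  compile*-correct []       xs = tt
  compile*-correct (t ∷ ts) xs = compile-correct t xs , compile*-correct ts xs

explicit : {f : Nary n} (t : Term n) → (∀ xs → (f $$ xs) ≡ ⟪ t ⟫ xs) → Total n f
explicit t f≗t = computes (compile t) λ xs →
  subst (Eval (compile t) xs) (sym (f≗t xs)) (compile-correct t xs)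

recursive : {f : Nary (suc n)} (z : Term n) (s : Term (suc (suc n))) →
            (∀ xs → (f 0 $$ xs) ≡ ⟪ z ⟫ xs) →
            (∀ m xs → (f (suc m) $$ xs) ≡ ⟪ s ⟫ (m ∷ (f m $$ xs) ∷ xs)) →
            Total (suc n) f
recursive {n} {f} z s f-zero f-suc =
  computes (prec (compile z) (compile s)) λ { (m ∷ xs) → go m xs }
  where
  go : ∀ m xs → Eval (prec (compile z) (compile s)) (m ∷ xs) (f m $$ xs)
  go zero    xs = subst (Eval (compile z) xs) (sym (f-zero xs)) (compile-correct z xs)
  go (suc m) xs = (f m $$ xs) , go m xs ,
    subst (Eval (compile s) _) (sym (f-suc m xs)) (compile-correct s _)

suc-total : Total 1 suc
suc-total = computes suc λ { (x ∷ []) → refl }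

pred-total : Total 1 pred
pred-total = recursive (lit 0) (# 0F) (λ { [] → refl }) (λ { m [] → refl })

+-total : Total 2 _+_
+-total = recursive (# 0F) (suc-total · # 1F ∷ []) (λ { (_ ∷ []) → refl }) (λ { m (_ ∷ []) → refl })

*-total : Total 2 _*_
*-total = recursive (lit 0) (+-total · # 2F ∷ # 1F ∷ [])
  (λ { (_ ∷ []) → refl }) (λ { m (_ ∷ []) → refl })

∸-total : Total 2 _∸_
∸-total = explicit (flipped · # 1F ∷ # 0F ∷ []) λ { (x ∷ y ∷ []) → refl }
  where
  flipped : Total 2 (λ y x → x ∸ y)
  flipped = recursive (# 0F) (pred-total · # 1F ∷ []) (λ { (_ ∷ []) → refl })
    (λ { m (x ∷ []) → sym (pred[m∸n]≡m∸[1+n] x m) })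

∣-∣-total : Total 2 ∣_-_∣
∣-∣-total = explicit
  (+-total · (∸-total · # 0F ∷ # 1F ∷ []) ∷ (∸-total · # 1F ∷ # 0F ∷ []) ∷ [])
  λ { (x ∷ y ∷ []) → dist x y }
  where
  dist : ∀ x y → ∣ x - y ∣ ≡ x ∸ y + (y ∸ x)
  dist zero    zero    = refl
  dist zero    (suc y) = refl
  dist (suc x) zero    = cong suc (sym (+-identityʳ x))
  dist (suc x) (suc y) = dist x y

2^-total : Total 1 (2 ^_)
2^-total = recursive (lit 1) (+-total · # 1F ∷ (+-total · # 1F ∷ lit 0 ∷ []) ∷ [])
  (λ { [] → refl }) (λ { m [] → refl })

ifz : ℕ → ℕ → ℕ → ℕ
ifz zero    a b = a
ifz (suc _) a b = b

ifz-total : Total 3 ifz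
ifz-total = recursive (# 0F) (# 3F)
  (λ { (_ ∷ _ ∷ []) → refl }) (λ { m (_ ∷ _ ∷ []) → refl })

-- Decidable conditions are represented by numbers, 0 being truth: then + is
-- conjunction, * disjunction, neg negation, ∑ bounded universal
-- quantification, and ∣ a - b ∣, a ∸ b stand for a ≡ b, a ≤ b.
neg : ℕ → ℕ
neg zero    = 1
neg (suc _) = 0

neg-total : Total 1 neg
neg-total = recursive (lit 1) (lit 0) (λ { [] → refl }) (λ { m [] → refl })

ifz-yes : ∀ {c a b} → c ≡ 0 → ifz c a b ≡ a
ifz-yes refl = refl

ifz-no : ∀ {c a b} → c ≢ 0 → ifz c a b ≡ b
ifz-no {zero}  c≢0 = contradiction refl c≢0
ifz-no {suc _} c≢0 = refl

ifz-elim : ∀ c {a b} (P : ℕ → Set) → (c ≡ 0 → P a) → (c ≢ 0 → P b) → P (ifz c a b)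
ifz-elim zero    P then else = then refl
ifz-elim (suc _) P then else = else λ ()

∑ : ℕ → (ℕ → ℕ) → ℕ
∑ zero    f = 0
∑ (suc n) f = ∑ n f + f n

∑-total : {f : Nary (suc n)} → Total (suc n) f →
          Total (suc n) (λ m → curryᵛ (λ xs → ∑ m (λ i → f i $$ xs)))
∑-total {n} {f} F = recursive (lit 0) (+-total · # 1F ∷ (F · # 0F ∷ params) ∷ [])
  (curryᵛ-$$ _)
  (λ m xs → trans (curryᵛ-$$ (λ xs → ∑ (suc m) (λ i → f i $$ xs)) xs)
    (cong₂ _+_ (sym (curryᵛ-$$ _ xs)) (cong (f m $$_) (sym (⟪params⟫ _ _ xs)))))
  where
  params : Vec (Term (suc (suc n))) n
  -- The recursion step receives the counter and the partial sum in front of the parameters, hence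
  -- the shift by two.
  params = map (λ i → # suc (suc i)) (allFin n)
  ⟪map⟫ : (is : Vec (Fin n) m) (a b : ℕ) (xs : Vec ℕ n) →
          ⟪ map (λ i → # suc (suc i)) is ⟫* (a ∷ b ∷ xs) ≡ map (lookup xs) is
  ⟪map⟫ []       a b xs = refl
  ⟪map⟫ (i ∷ is) a b xs = cong (lookup xs i ∷_) (⟪map⟫ is a b xs)
  ⟪params⟫ : ∀ a b (xs : Vec ℕ n) → ⟪ params ⟫* (a ∷ b ∷ xs) ≡ xs
  ⟪params⟫ a b xs = trans (⟪map⟫ (allFin n) a b xs) (map-lookup-allFin xs)

-- Minimisation and enumerable relations

minimisation : {f : Nary (suc n)} → Total (suc n) f → (g : Nary n) →
               (∀ xs → (f (g $$ xs) $$ xs) ≡ 0) →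
               (∀ xs i → i < (g $$ xs) → (f i $$ xs) ≢ 0) →
               Total n g
minimisation {f = f} F g zero-at least = computes (μ (code F)) λ xs →
  subst (Eval (code F) ((g $$ xs) ∷ xs)) (zero-at xs) (correct F ((g $$ xs) ∷ xs)) ,
  λ i i<g → pred (f i $$ xs) ,
    subst (Eval (code F) (i ∷ xs)) (sym (suc-pred _ {{≢-nonZero (least xs i i<g)}}))
      (correct F (i ∷ xs))

μ-least : (f : ℕ → ℕ) → ∃[ t ] f t ≡ 0 → ∃[ t ] f t ≡ 0 × (∀ i → i < t → f i ≢ 0)
-- The known zero bounds the search: remaining steps plus current candidate always add up to it.
μ-least f (t , ft≡0) = search t 0 (subst (λ u → f u ≡ 0) (sym (+-identityʳ t)) ft≡0) λ _ ()
  where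
  search : ∀ d s → f (d + s) ≡ 0 → (∀ i → i < s → f i ≢ 0) →
           ∃[ t ] f t ≡ 0 × (∀ i → i < t → f i ≢ 0)
  search zero    s eq below = s , eq , below
  search (suc d) s eq below with f s ≟ 0
  ... | yes fs≡0 = s , fs≡0 , below
  ... | no  fs≢0 = search d (suc s) (trans (cong f (+-suc d s)) eq) λ i i<1+s →
    case (m<1+n⇒m<n∨m≡n i<1+s) of λ { (inj₁ i<s) → below i i<s ; (inj₂ refl) → fs≢0 }

Eval-zero-search : {f : Nary (suc n)} (F : Total (suc n) f) (xs : Vec ℕ n) →
                   (∃[ t ] Eval (μ (code F)) xs t) ⇔ (∃[ t ] (f t $$ xs) ≡ 0)
Eval-zero-search {f = f} F xs = mk⇔
  (λ { (t , eval , _) → t , Eval-functional (code F) _ (correct F (t ∷ xs)) eval })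
  (λ ∃t → let t , ft≡0 , least = μ-least (λ t → f t $$ xs) ∃t in
    t , subst (Eval (code F) (t ∷ xs)) ft≡0 (correct F (t ∷ xs)) ,
    λ i i<t → pred (f i $$ xs) ,
      subst (Eval (code F) (i ∷ xs)) (sym (suc-pred _ {{≢-nonZero (least i i<t)}}))
        (correct F (i ∷ xs)))

domain-CE : {f : Nary 3} → Total 3 f → IsCE (λ x y → ∃[ t ] f t x y ≡ 0)
domain-CE F = ⟦ μ (code F) ⟧ , (μ (code F) , λ xs y → mk⇔ id id) , λ x y →
  mk⇔ (Equivalence.from (Eval-zero-search F (x ∷ y ∷ [])))
      (Equivalence.to (Eval-zero-search F (x ∷ y ∷ [])))

-- A stage function computes a partial value in the limit: 0 stands for
-- "not yet defined" and suc v for "defined with value v".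

Persistent : (ℕ → ℕ) → Set
Persistent h = ∀ t v → h t ≡ suc v → h (suc t) ≡ suc v

infix 4 _↓_

_↓_ : (ℕ → ℕ) → ℕ → Set
h ↓ v = ∃[ t ] h t ≡ suc v

module _ {h : ℕ → ℕ} (persistent : Persistent h) where

  persists : ∀ {t u v} → t ≤ u → h t ≡ suc v → h u ≡ suc v
  persists t≤u eq = go (≤⇒≤′ t≤u) eq
    where
    go : ∀ {t u v} → t ≤′ u → h t ≡ suc v → h u ≡ suc v
    go ≤′-refl       eq = eq
    go (≤′-step t≤u) eq = persistent _ _ (go t≤u eq)

  ↓-functional : ∀ {v w} → h ↓ v → h ↓ w → v ≡ w
  ↓-functional (t , eq) (u , eq′) = suc-injective (trans
    (sym (persists (m≤m⊔n t u) eq)) (persists (m≤n⊔m t u) eq′))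

limit : {h : Nary (suc n)} → (∀ xs → Persistent (λ t → h t $$ xs)) → Vec ℕ n ⇀ ℕ
limit {h = h} persistent = record
  { graph      = λ xs v → (λ t → h t $$ xs) ↓ v
  ; functional = λ {xs} → ↓-functional (persistent xs)
  }

-- Minimisation finds the first stage at which the value is defined, and by persistence the value
-- shown there is the limit.
limit-computable : {h : Nary (suc n)} (H : Total (suc n) h)
                   (persistent : ∀ xs → Persistent (λ t → h t $$ xs)) →
                   PartialComputable (limit {h = h} persistent)
limit-computable {n} {h} H persistent = comp value (search ∷ projections (allFin n)) ,
  λ xs v → mk⇔ (to xs v) (from xs v)
  where
  value : Rec (suc n)
  value = comp (code pred-total) (code H ∷ [])
  undefined : Rec (suc n)
  undefined = comp (code neg-total) (code H ∷ [])
  search : Rec n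
  search = μ undefined
  projections : Vec (Fin n) m → Vec (Rec n) m
  projections = map proj
  all-args : (is : Vec (Fin n) m) (xs : Vec ℕ n) → EvalAll (projections is) xs (map (lookup xs) is)
  all-args []       xs = tt
  all-args (i ∷ is) xs = refl , all-args is xs
  args : (xs : Vec ℕ n) → EvalAll (projections (allFin n)) xs xs
  args xs = subst (EvalAll _ xs) (map-lookup-allFin xs) (all-args (allFin n) xs)
  undefined-eval : ∀ t xs → Eval undefined (t ∷ xs) (neg (h t $$ xs))
  undefined-eval t xs = (h t $$ xs) ∷ [] , (correct H (t ∷ xs) , tt) , correct neg-total ((h t $$ xs) ∷ [])
  value-eval : ∀ t xs → Eval value (t ∷ xs) (pred (h t $$ xs))
  value-eval t xs = (h t $$ xs) ∷ [] , (correct H (t ∷ xs) , tt) , correct pred-total ((h t $$ xs) ∷ [])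

  to : ∀ xs v → (λ t → h t $$ xs) ↓ v → Eval (comp value (search ∷ projections (allFin n))) xs v
  to xs v (t , eq)
    with s , hs≡0 , least ← μ-least (λ t → neg (h t $$ xs)) (t , cong neg eq) =
    s ∷ xs ,
    ((subst (Eval undefined (s ∷ xs)) hs≡0 (undefined-eval s xs) ,
      λ i i<s → pred (neg (h i $$ xs)) , subst (Eval undefined (i ∷ xs))
        (sym (suc-pred _ {{≢-nonZero (least i i<s)}})) (undefined-eval i xs)) , args xs) ,
    subst (Eval value (s ∷ xs)) (pred-eq (h s $$ xs) refl hs≡0) (value-eval s xs)
    where
    pred-eq : ∀ a → a ≡ (h s $$ xs) → neg a ≡ 0 → pred a ≡ v
    pred-eq (suc a) eq′ _ = ↓-functional (persistent xs) (s , sym eq′) (t , eq)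

  from : ∀ xs v → Eval (comp value (search ∷ projections (allFin n))) xs v → (λ t → h t $$ xs) ↓ v
  from xs v (t ∷ ys , ((zero-at , _) , ys-eval) , value-at)
    with refl ← EvalAll-functional _ xs ys xs ys-eval (args xs) =
    t , defined (h t $$ xs) (Eval-functional undefined (t ∷ xs) (undefined-eval t xs) zero-at)
          (Eval-functional value (t ∷ xs) (value-eval t xs) value-at)
    where
    defined : ∀ a → neg a ≡ 0 → pred a ≡ v → a ≡ suc v
    defined (suc a) _ eq = cong suc eq

PartialComputable-resp-≐ : {f g : Vec ℕ n ⇀ ℕ} → f ≐ g → PartialComputable f → PartialComputable g
PartialComputable-resp-≐ f≐g (c , f≐c) = c , λ xs v → f≐c xs v ⇔-∘ ⇔-sym (f≐g xs v)

IsCE-resp-⇔ : {R S : Rel ℕ 0ℓ} → (∀ x y → R x y ⇔ S x y) → IsCE S → IsCE R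
IsCE-resp-⇔ R⇔S (f , computable , domain) =
  f , computable , λ x y → domain x y ⇔-∘ R⇔S x y

-- Cantor's pairing function

triangle : ℕ → ℕ
triangle zero    = 0
triangle (suc w) = suc w + triangle w

-- The number of the antidiagonal that contains the pair coded by `n`: the largest w with
-- `triangle w ≤ n`. It grows exactly when `n` reaches the next triangular number, which allows the
-- recursion.
diagonal : ℕ → ℕ
diagonal zero    = 0
diagonal (suc n) = ifz (triangle (suc (diagonal n)) ∸ suc n) (suc (diagonal n)) (diagonal n)

opaque

  ⟨_,_⟩ : ℕ → ℕ → ℕ
  ⟨ a , b ⟩ = triangle (a + b) + b

  π₂ : ℕ → ℕ
  π₂ n = n ∸ triangle (diagonal n)

  π₁ : ℕ → ℕ
  π₁ n = diagonal n ∸ π₂ n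

  triangle-total : Total 1 triangle
  triangle-total = recursive (lit 0)
    (+-total · (suc-total · # 0F ∷ []) ∷ # 1F ∷ []) (λ { [] → refl }) (λ { m [] → refl })

  diagonal-total : Total 1 diagonal
  diagonal-total = recursive (lit 0)
    (ifz-total · (∸-total · (triangle-total · (suc-total · # 1F ∷ []) ∷ []) ∷
                            (suc-total · # 0F ∷ []) ∷ []) ∷
                 (suc-total · # 1F ∷ []) ∷ # 1F ∷ [])
    (λ { [] → refl }) (λ { m [] → refl })

  ⟨,⟩-total : Total 2 ⟨_,_⟩
  ⟨,⟩-total = explicit
    (+-total · (triangle-total · (+-total · # 0F ∷ # 1F ∷ []) ∷ []) ∷ # 1F ∷ [])
    (λ { (_ ∷ _ ∷ []) → refl })

  π₂-total : Total 1 π₂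
  π₂-total = explicit
    (∸-total · # 0F ∷ (triangle-total · (diagonal-total · # 0F ∷ []) ∷ []) ∷ [])
    (λ { (_ ∷ []) → refl })

  π₁-total : Total 1 π₁
  π₁-total = explicit
    (∸-total · (diagonal-total · # 0F ∷ []) ∷ (π₂-total · # 0F ∷ []) ∷ [])
    (λ { (_ ∷ []) → refl })

  triangle-mono : ∀ {v w} → v ≤ w → triangle v ≤ triangle w
  triangle-mono {zero}  v≤w       = z≤n
  triangle-mono {suc v} (s≤s v≤w) = +-mono-≤ (s≤s v≤w) (triangle-mono v≤w)

  diagonal-bounds : ∀ n → triangle (diagonal n) ≤ n × n < triangle (suc (diagonal n))
  diagonal-bounds zero    = z≤n , s≤s z≤n
  diagonal-bounds (suc n) with diagonal-bounds n | triangle (suc (diagonal n)) ∸ suc n in eq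
  ... | lower , upper | zero  = m∸n≡0⇒m≤n eq ,
    s≤s (≤-trans upper (m≤n+m _ (suc (diagonal n))))
  ... | lower , upper | suc _ = m≤n⇒m≤1+n lower , m∸n≢0⇒n<m λ eq′ → case trans (sym eq) eq′ of λ ()

  diagonal-unique : ∀ w n → triangle w ≤ n → n < triangle (suc w) → diagonal n ≡ w
  diagonal-unique w n lower upper with diagonal-bounds n | <-cmp (diagonal n) w
  ... | lower′ , upper′ | tri≈ _ eq _ = eq
  ... | lower′ , upper′ | tri< d<w _ _ =
    contradiction (<-≤-trans upper′ (≤-trans (triangle-mono d<w) lower)) (<-irrefl refl)
  ... | lower′ , upper′ | tri> _ _ w<d =
    contradiction (<-≤-trans upper (≤-trans (triangle-mono w<d) lower′)) (<-irrefl refl)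

  diagonal-⟨,⟩ : ∀ a b → diagonal ⟨ a , b ⟩ ≡ a + b
  diagonal-⟨,⟩ a b = diagonal-unique (a + b) _ (m≤m+n _ b)
    (subst (_< triangle (suc (a + b))) (+-comm b _)
      (+-monoˡ-< (triangle (a + b)) (s≤s (m≤n+m b a))))

  π₂-⟨,⟩ : ∀ a b → π₂ ⟨ a , b ⟩ ≡ b
  π₂-⟨,⟩ a b = trans (cong (λ w → ⟨ a , b ⟩ ∸ triangle w) (diagonal-⟨,⟩ a b))
    (m+n∸m≡n (triangle (a + b)) b)

  π₁-⟨,⟩ : ∀ a b → π₁ ⟨ a , b ⟩ ≡ a
  π₁-⟨,⟩ a b = trans (cong₂ _∸_ (diagonal-⟨,⟩ a b) (π₂-⟨,⟩ a b)) (m+n∸n≡m a b)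

  ⟨π₁,π₂⟩ : ∀ n → ⟨ π₁ n , π₂ n ⟩ ≡ n
  ⟨π₁,π₂⟩ n = trans (cong (λ w → triangle w + π₂ n) (m∸n+n≡m π₂≤)) (m+[n∸m]≡n (proj₁ (diagonal-bounds n)))
    where
    π₂≤ : π₂ n ≤ diagonal n
    π₂≤ = m≤n+o⇒m∸n≤o n (triangle (diagonal n)) (subst (n ≤_)
      (+-comm (diagonal n) (triangle (diagonal n))) (≤-pred (proj₂ (diagonal-bounds n))))

-- A universal machine

-- A state ⟨ v , k ⟩ is a current value and a stack of instructions; the
-- machine halts on the empty stack 0.  Tags 0–7 are the instructions of
-- programs, tags 8–11 are created at run time and carry saved values.

push : ℕ → ℕ → ℕ
push i k = suc ⟨ i , k ⟩

instr : ℕ → ℕ → ℕ → ℕ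
instr tag a b = ⟨ tag , ⟨ a , b ⟩ ⟩

-- Tags 8 and 9 resume the evaluation of a tuple after its head and after its tail, tag 10 hands a
-- recursive value to the step function of `prec`, and tag 11 tests a value of a function under
-- minimisation.
exec : (tag a b v k : ℕ) → ℕ
exec 0  a b v k = ⟨ 0 , k ⟩
exec 1  a b v k = ⟨ suc (π₁ v) , k ⟩
exec 2  a b v k = ⟨ π₁ v , k ⟩
exec 3  a b v k = ⟨ π₂ v , k ⟩
exec 4  a b v k = ⟨ v , push b (push a k) ⟩
exec 5  a b v k = ⟨ v , push a (push (instr 8 b v) k) ⟩
exec 6  a b v k = ifz (π₁ v) ⟨ π₂ v , push a k ⟩
  ⟨ ⟨ pred (π₁ v) , π₂ v ⟩ , push (instr 6 a b) (push (instr 10 (pred (π₁ v)) (π₂ v)) (push b k)) ⟩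
exec 7  a b v k = ⟨ ⟨ 0 , v ⟩ , push a (push (instr 11 a ⟨ 0 , v ⟩) k) ⟩
exec 8  a b v k = ⟨ b , push a (push (instr 9 v 0) k) ⟩
exec 9  a b v k = ⟨ ⟨ a , v ⟩ , k ⟩
exec 10 a b v k = ⟨ ⟨ a , ⟨ v , b ⟩ ⟩ , k ⟩
exec _  a b v k = ifz v ⟨ π₁ b , k ⟩
  ⟨ ⟨ suc (π₁ b) , π₂ b ⟩ , push a (push (instr 11 a ⟨ suc (π₁ b) , π₂ b ⟩) k) ⟩

step : ℕ → ℕ
step s = ifz (π₂ s) s
  (exec (π₁ (π₁ (pred (π₂ s)))) (π₁ (π₂ (π₁ (pred (π₂ s))))) (π₂ (π₂ (π₁ (pred (π₂ s)))))
        (π₁ s) (π₂ (pred (π₂ s))))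

steps : ℕ → ℕ → ℕ
steps zero    s = s
steps (suc t) s = step (steps t s)

output : ℕ → ℕ
output s = ifz (π₂ s) (suc (π₁ s)) 0

run : ℕ → ℕ → ℕ → ℕ
run t i v = output (steps t ⟨ v , push i 0 ⟩)

-- The last branch is the default for all larger tags, in accordance with the final clauses of
-- `exec` and `decodeTagged`.
switch : Term n → Vec (Term n) (suc m) → Term n
switch t (a ∷ [])     = a
switch t (a ∷ b ∷ bs) = ifz-total · t ∷ a ∷ switch (pred-total · t ∷ []) (b ∷ bs) ∷ []

exec-total : Total 5 exec
exec-total = explicit (switch tag (
    pairT (lit 0) κ
  ∷ pairT (sucT (fst v)) κ
  ∷ pairT (fst v) κ
  ∷ pairT (snd v) κ
  ∷ pairT v (pushT b (pushT a κ))
  ∷ pairT v (pushT a (pushT (instrT 8 b v) κ))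
  ∷ (ifz-total · fst v ∷ pairT (snd v) (pushT a κ)
       ∷ pairT (pairT (predT (fst v)) (snd v))
           (pushT (instrT 6 a b) (pushT (instrT 10 (predT (fst v)) (snd v)) (pushT b κ))) ∷ [])
  ∷ pairT (pairT (lit 0) v) (pushT a (pushT (instrT 11 a (pairT (lit 0) v)) κ))
  ∷ pairT b (pushT a (pushT (instrT 9 v (lit 0)) κ))
  ∷ pairT (pairT a v) κ
  ∷ pairT (pairT a (pairT v b)) κ
  ∷ (ifz-total · v ∷ pairT (fst b) κ
       ∷ pairT (pairT (sucT (fst b)) (snd b))
           (pushT a (pushT (instrT 11 a (pairT (sucT (fst b)) (snd b))) κ)) ∷ [])
  ∷ [])) exec≗
  where
  T = Term 5
  tag a b v κ : T
  tag = # 0F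
  a = # 1F
  b = # 2F
  v = # 3F
  κ = # 4F
  pairT pushT : T → T → T
  pairT t u = ⟨,⟩-total · t ∷ u ∷ []
  sucT predT fst snd : T → T
  sucT t = suc-total · t ∷ []
  predT t = pred-total · t ∷ []
  pushT t u = sucT (pairT t u)
  fst t = π₁-total · t ∷ []
  snd t = π₂-total · t ∷ []
  instrT : ℕ → T → T → T
  instrT n t u = pairT (lit n) (pairT t u)
  exec≗ : ∀ xs → _ ≡ _
  exec≗ (0  ∷ _ ∷ _ ∷ _ ∷ _ ∷ []) = refl
  exec≗ (1  ∷ _ ∷ _ ∷ _ ∷ _ ∷ []) = refl
  exec≗ (2  ∷ _ ∷ _ ∷ _ ∷ _ ∷ []) = refl
  exec≗ (3  ∷ _ ∷ _ ∷ _ ∷ _ ∷ []) = refl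
  exec≗ (4  ∷ _ ∷ _ ∷ _ ∷ _ ∷ []) = refl
  exec≗ (5  ∷ _ ∷ _ ∷ _ ∷ _ ∷ []) = refl
  exec≗ (6  ∷ _ ∷ _ ∷ _ ∷ _ ∷ []) = refl
  exec≗ (7  ∷ _ ∷ _ ∷ _ ∷ _ ∷ []) = refl
  exec≗ (8  ∷ _ ∷ _ ∷ _ ∷ _ ∷ []) = refl
  exec≗ (9  ∷ _ ∷ _ ∷ _ ∷ _ ∷ []) = refl
  exec≗ (10 ∷ _ ∷ _ ∷ _ ∷ _ ∷ []) = refl
  exec≗ (suc (suc (suc (suc (suc (suc (suc (suc (suc (suc (suc _))))))))))
            ∷ _ ∷ _ ∷ _ ∷ _ ∷ []) = refl

step-total : Total 1 step
step-total = explicit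
  (ifz-total · snd s ∷ s ∷
    (exec-total · fst (fst κ) ∷ fst (snd (fst κ)) ∷ snd (snd (fst κ)) ∷ fst s ∷ snd κ ∷ []) ∷ [])
  λ { (_ ∷ []) → refl }
  where
  fst snd : Term 1 → Term 1
  fst t = π₁-total · t ∷ []
  snd t = π₂-total · t ∷ []
  s κ : Term 1
  s = # 0F
  κ = pred-total · snd s ∷ []

steps-total : Total 2 steps
steps-total = recursive (# 0F) (step-total · # 1F ∷ [])
  (λ { (_ ∷ []) → refl }) (λ { m (_ ∷ []) → refl })

run-total : Total 3 run
run-total = explicit
  (ifz-total · (π₂-total · s ∷ []) ∷ (suc-total · (π₁-total · s ∷ []) ∷ []) ∷ lit 0 ∷ [])
  λ { (_ ∷ _ ∷ _ ∷ []) → refl }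
  where
  s : Term 3
  s = steps-total · # 0F ∷
    (⟨,⟩-total · # 2F ∷ (suc-total · (⟨,⟩-total · # 1F ∷ lit 0 ∷ []) ∷ []) ∷ []) ∷ []

step-push : ∀ v tag a b k → step ⟨ v , push (instr tag a b) k ⟩ ≡ exec tag a b v k
step-push v tag a b k
  rewrite π₂-⟨,⟩ v (push (instr tag a b) k) | π₁-⟨,⟩ v (push (instr tag a b) k)
        | π₁-⟨,⟩ (instr tag a b) k | π₂-⟨,⟩ (instr tag a b) k
        | π₁-⟨,⟩ tag ⟨ a , b ⟩ | π₂-⟨,⟩ tag ⟨ a , b ⟩
        | π₁-⟨,⟩ a b | π₂-⟨,⟩ a b = refl

step-halted : ∀ s → π₂ s ≡ 0 → step s ≡ s
step-halted s eq = ifz-yes eq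

steps-step : ∀ t s → steps t (step s) ≡ steps (suc t) s
steps-step zero    s = refl
steps-step (suc t) s = cong step (steps-step t s)

steps-+ : ∀ t u s → steps (t + u) s ≡ steps t (steps u s)
steps-+ zero    u s = refl
steps-+ (suc t) u s = cong step (steps-+ t u s)

steps-halted : ∀ t v → steps t ⟨ v , 0 ⟩ ≡ ⟨ v , 0 ⟩
steps-halted zero    v = refl
steps-halted (suc t) v =
  trans (cong step (steps-halted t v)) (step-halted _ (π₂-⟨,⟩ v 0))

⟨,⟩-injective : ∀ {a b c d} → ⟨ a , b ⟩ ≡ ⟨ c , d ⟩ → a ≡ c × b ≡ d
⟨,⟩-injective {a} {b} {c} {d} eq =
  trans (sym (π₁-⟨,⟩ a b)) (trans (cong π₁ eq) (π₁-⟨,⟩ c d)) ,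
  trans (sym (π₂-⟨,⟩ a b)) (trans (cong π₂ eq) (π₂-⟨,⟩ c d))

output-halted : ∀ s v → output s ≡ suc v → s ≡ ⟨ v , 0 ⟩
output-halted s v eq with π₂ s in π₂s≡
... | zero = trans (sym (⟨π₁,π₂⟩ s)) (cong₂ ⟨_,_⟩ (suc-injective eq) π₂s≡)

output-⟨,⟩ : ∀ v → output ⟨ v , 0 ⟩ ≡ suc v
output-⟨,⟩ v rewrite π₂-⟨,⟩ v 0 | π₁-⟨,⟩ v 0 = refl

run-persistent : ∀ i v → Persistent (λ t → run t i v)
run-persistent i v t w eq
  rewrite output-halted (steps t ⟨ v , push i 0 ⟩) w eq
        | step-halted ⟨ w , 0 ⟩ (π₂-⟨,⟩ w 0) = output-⟨,⟩ w

encodeᵛ : Vec ℕ k → ℕ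
encodeᵛ []       = 0
encodeᵛ (x ∷ xs) = ⟨ x , encodeᵛ xs ⟩

encode-proj : Fin k → ℕ
encode-proj zero    = instr 2 0 0
encode-proj (suc i) = instr 4 (encode-proj i) (instr 3 0 0)

mutual
  encode : Rec k → ℕ
  encode zero        = instr 0 0 0
  encode suc         = instr 1 0 0
  encode (proj i)    = encode-proj i
  encode (comp f gs) = instr 4 (encode f) (encode* gs)
  encode (prec f g)  = instr 6 (encode f) (encode g)
  encode (μ f)       = instr 7 (encode f) 0

  encode* : Vec (Rec k) m → ℕ
  encode* []       = instr 0 0 0
  encode* (g ∷ gs) = instr 5 (encode g) (encode* gs)

infix 3 _⟶_

_⟶_ : ℕ → ℕ → Set
s ⟶ s′ = ∃[ t ] steps t s ≡ s′

⟶-trans : ∀ {r s u} → r ⟶ s → s ⟶ u → r ⟶ u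
⟶-trans {r} (t , refl) (t′ , refl) = t′ + t , steps-+ t′ t r

⟶-exec : ∀ {v a b k s} tag → exec tag a b v k ⟶ s → ⟨ v , push (instr tag a b) k ⟩ ⟶ s
⟶-exec {v} {a} {b} {k} tag = ⟶-trans (1 , step-push v tag a b k)

done : ∀ {s s′} → s ≡ s′ → s ⟶ s′
done eq = 0 , eq

proj-run : (i : Fin n) (xs : Vec ℕ n) (k : ℕ) →
           ⟨ encodeᵛ xs , push (encode-proj i) k ⟩ ⟶ ⟨ lookup xs i , k ⟩
proj-run zero    (x ∷ xs) k = ⟶-exec 2 (done (cong ⟨_, k ⟩ (π₁-⟨,⟩ x _)))
proj-run (suc i) (x ∷ xs) k = ⟶-exec 4 (⟶-exec 3 (⟶-trans
  (done (cong ⟨_, push (encode-proj i) k ⟩ (π₂-⟨,⟩ x _))) (proj-run i xs k)))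

exec-prec-zero : ∀ a b x k → exec 6 a b ⟨ 0 , x ⟩ k ≡ ⟨ x , push a k ⟩
exec-prec-zero a b x k rewrite π₁-⟨,⟩ 0 x | π₂-⟨,⟩ 0 x = refl

exec-prec-suc : ∀ a b m x k → exec 6 a b ⟨ suc m , x ⟩ k ≡
  ⟨ ⟨ m , x ⟩ , push (instr 6 a b) (push (instr 10 m x) (push b k)) ⟩
exec-prec-suc a b m x k rewrite π₁-⟨,⟩ (suc m) x | π₂-⟨,⟩ (suc m) x = refl

exec-test-suc : ∀ a i x w k → exec 11 a ⟨ i , x ⟩ (suc w) k ≡
  ⟨ ⟨ suc i , x ⟩ , push a (push (instr 11 a ⟨ suc i , x ⟩) k) ⟩
exec-test-suc a i x w k rewrite π₁-⟨,⟩ i x | π₂-⟨,⟩ i x = refl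

mutual
  -- The stack `k` is arbitrary because subprograms run on top of pending instructions.
  encode-run : (c : Rec n) (xs : Vec ℕ n) {y : ℕ} → Eval c xs y →
               ∀ k → ⟨ encodeᵛ xs , push (encode c) k ⟩ ⟶ ⟨ y , k ⟩
  encode-run zero        xs       refl k = ⟶-exec 0 (done refl)
  encode-run suc         (x ∷ []) refl k =
    ⟶-exec 1 (done (cong (λ x → ⟨ suc x , k ⟩) (π₁-⟨,⟩ x 0)))
  encode-run (proj i)    xs       refl k = proj-run i xs k
  encode-run (comp f gs) xs (zs , ps , p) k =
    ⟶-exec 4 (⟶-trans (encode*-run gs xs zs ps _) (encode-run f zs p k))
  encode-run (prec f g) (zero ∷ xs) p k =
    ⟶-exec 6 (⟶-trans (done (exec-prec-zero _ _ _ k)) (encode-run f xs p k))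
  encode-run (prec f g) (suc m ∷ xs) (z , p , q) k =
    ⟶-exec 6 (⟶-trans (done (exec-prec-suc _ _ m _ k))
      (⟶-trans (encode-run (prec f g) (m ∷ xs) p _)
        (⟶-exec 10 (encode-run g (m ∷ z ∷ xs) q k))))
  encode-run (μ f) xs {y} (p , below) k = ⟶-exec 7 (loop y 0 (+-identityʳ y))
    where
    test : ℕ → ℕ
    test i = push (instr 11 (encode f) ⟨ i , encodeᵛ xs ⟩) k
    loop : ∀ d i → d + i ≡ y → ⟨ ⟨ i , encodeᵛ xs ⟩ , push (encode f) (test i) ⟩ ⟶ ⟨ y , k ⟩
    loop zero    i refl = ⟶-trans (encode-run f (i ∷ xs) p _)
      (⟶-exec 11 (done (cong ⟨_, k ⟩ (π₁-⟨,⟩ i _))))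
    loop (suc d) i eq with w , q ← below i (subst (i <_) eq (s≤s (m≤n+m i d))) =
      ⟶-trans (encode-run f (i ∷ xs) q _) (⟶-exec 11
        (⟶-trans (done (exec-test-suc _ i _ w k)) (loop d (suc i) (trans (+-suc d i) eq))))

  encode*-run : (gs : Vec (Rec n) m) (xs : Vec ℕ n) (zs : Vec ℕ m) → EvalAll gs xs zs →
                ∀ k → ⟨ encodeᵛ xs , push (encode* gs) k ⟩ ⟶ ⟨ encodeᵛ zs , k ⟩
  encode*-run []       xs []       _       k = ⟶-exec 0 (done refl)
  encode*-run (g ∷ gs) xs (z ∷ zs) (p , q) k =
    ⟶-exec 5 (⟶-trans (encode-run g xs p _) (⟶-exec 8
      (⟶-trans (encode*-run gs xs zs q _) (⟶-exec 9 (done refl)))))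

-- Conversely, a run that empties the stack must at some point have
-- popped the code of c, having evaluated c.

record Ends (v t s : ℕ) : Set where
  constructor mkEnds
  field
    empties : steps t s ≡ ⟨ v , 0 ⟩

Ends-exec : ∀ {v w a b k} tag t → Ends v t ⟨ w , push (instr tag a b) k ⟩ →
            ∃[ t′ ] t′ < t × Ends v t′ (exec tag a b w k)
Ends-exec tag zero    (mkEnds ends) with () ← proj₂ (⟨,⟩-injective ends)
Ends-exec {w = w} {a} {b} {k} tag (suc t) (mkEnds ends) = t , n<1+n t ,
  mkEnds (trans (cong (steps t) (sym (step-push w tag a b k))) (trans (steps-step t _) ends))

Ends-≡ : ∀ {v t s s′} → s ≡ s′ → Ends v t s → Ends v t s′
Ends-≡ refl ends = ends

-- The remaining time decreases strictly: it is the measure that bounds the loop of a minimisation,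
-- where the code does not get smaller.
Evaluates : ℕ → ℕ → ℕ → (ℕ → Set) → Set
Evaluates v t k P = ∃[ y ] P y × (∃[ t′ ] t′ < t × Ends v t′ ⟨ y , k ⟩)

proj-sound : ∀ {v} (i : Fin n) (xs : Vec ℕ n) k t →
             Ends v t ⟨ encodeᵛ xs , push (encode-proj i) k ⟩ →
             Evaluates v t k (_≡ lookup xs i)
proj-sound zero    (x ∷ xs) k t ends with t′ , t′<t , ends′ ← Ends-exec 2 t ends =
  x , refl , t′ , t′<t , Ends-≡ (cong ⟨_, k ⟩ (π₁-⟨,⟩ x _)) ends′
proj-sound (suc i) (x ∷ xs) k t ends
  with t₁ , t₁<t , ends₁ ← Ends-exec 4 t ends
  with t₂ , t₂<t₁ , ends₂ ← Ends-exec 3 t₁ ends₁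
  with y , eq , t₃ , t₃<t₂ , ends₃ ←
    proj-sound i xs k t₂ (Ends-≡ (cong ⟨_, _ ⟩ (π₂-⟨,⟩ x _)) ends₂) =
  y , eq , t₃ , <-trans t₃<t₂ (<-trans t₂<t₁ t₁<t) , ends₃

mutual
  encode-sound : ∀ {v} (c : Rec n) (xs : Vec ℕ n) k t →
                 Ends v t ⟨ encodeᵛ xs , push (encode c) k ⟩ → Evaluates v t k (Eval c xs)
  encode-sound zero xs k t ends with t′ , t′<t , ends′ ← Ends-exec 0 t ends =
    0 , refl , t′ , t′<t , ends′
  encode-sound suc (x ∷ []) k t ends with t′ , t′<t , ends′ ← Ends-exec 1 t ends =
    suc x , refl , t′ , t′<t , Ends-≡ (cong (λ x → ⟨ suc x , k ⟩) (π₁-⟨,⟩ x 0)) ends′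
  encode-sound (proj i) xs k t ends = proj-sound i xs k t ends
  encode-sound (comp f gs) xs k t ends
    with t₁ , t₁<t , ends₁ ← Ends-exec 4 t ends
    with zs , ps , t₂ , t₂<t₁ , ends₂ ← encode*-sound gs xs _ t₁ ends₁
    with y , p , t₃ , t₃<t₂ , ends₃ ← encode-sound f zs k t₂ ends₂ =
    y , (zs , ps , p) , t₃ , <-trans t₃<t₂ (<-trans t₂<t₁ t₁<t) , ends₃
  encode-sound (prec f g) (m ∷ xs) k t ends = prec-sound f g m xs k t ends
  encode-sound {v = v} (μ f) xs k t ends
    with t₁ , t₁<t , ends₁ ← Ends-exec 7 t ends =
    let y , p , t₂ , t₂<1+t₁ , ends₂ = loop (suc t₁) t₁ (n<1+n t₁) 0 (λ _ ()) ends₁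
    in y , p , t₂ , <-≤-trans t₂<1+t₁ t₁<t , ends₂
    where
    loop : ∀ T t → t < T → ∀ i → (∀ j → j < i → ∃[ z ] Eval f (j ∷ xs) (suc z)) →
           Ends v t ⟨ ⟨ i , encodeᵛ xs ⟩ ,
             push (encode f) (push (instr 11 (encode f) ⟨ i , encodeᵛ xs ⟩) k) ⟩ →
           Evaluates v T k (Eval (μ f) xs)
    loop (suc T) t (s≤s t≤T) i below ends
      with w , p , t₁ , t₁<t , ends₁ ← encode-sound f (i ∷ xs) _ t ends
      with t₂ , t₂<t₁ , ends₂ ← Ends-exec 11 t₁ ends₁
      with w
    ... | zero = i , (p , below) , t₂ , m≤n⇒m≤1+n (<-≤-trans (<-trans t₂<t₁ t₁<t) t≤T) ,
      Ends-≡ (cong ⟨_, k ⟩ (π₁-⟨,⟩ i _)) ends₂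
    ... | suc w′ with y , q , t₃ , t₃<T , ends₃ ←
      loop T t₂ (<-≤-trans (<-trans t₂<t₁ t₁<t) t≤T) (suc i)
        (λ j j<1+i → case m<1+n⇒m<n∨m≡n j<1+i of λ
          { (inj₁ j<i) → below j j<i ; (inj₂ refl) → w′ , p })
        (Ends-≡ (exec-test-suc _ i _ w′ k) ends₂) =
      y , q , t₃ , m≤n⇒m≤1+n t₃<T , ends₃

  prec-sound : ∀ {v} (f : Rec n) (g : Rec (suc (suc n))) m (xs : Vec ℕ n) k t →
               Ends v t ⟨ ⟨ m , encodeᵛ xs ⟩ , push (encode (prec f g)) k ⟩ →
               Evaluates v t k (Eval (prec f g) (m ∷ xs))
  prec-sound f g zero xs k t ends
    with t₁ , t₁<t , ends₁ ← Ends-exec 6 t ends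
    with y , p , t₂ , t₂<t₁ , ends₂ ←
      encode-sound f xs k t₁ (Ends-≡ (exec-prec-zero _ _ _ k) ends₁) =
    y , p , t₂ , <-trans t₂<t₁ t₁<t , ends₂
  prec-sound f g (suc m) xs k t ends
    with t₁ , t₁<t , ends₁ ← Ends-exec 6 t ends
    with z , p , t₂ , t₂<t₁ , ends₂ ←
      prec-sound f g m xs _ t₁ (Ends-≡ (exec-prec-suc _ _ m _ k) ends₁)
    with t₃ , t₃<t₂ , ends₃ ← Ends-exec 10 t₂ ends₂
    with y , q , t₄ , t₄<t₃ , ends₄ ← encode-sound g (m ∷ z ∷ xs) k t₃ ends₃ =
    y , (z , p , q) , t₄ , <-trans t₄<t₃ (<-trans t₃<t₂ (<-trans t₂<t₁ t₁<t)) , ends₄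

  encode*-sound : ∀ {v} (gs : Vec (Rec n) m) (xs : Vec ℕ n) k t →
                  Ends v t ⟨ encodeᵛ xs , push (encode* gs) k ⟩ →
                  ∃[ zs ] EvalAll gs xs zs × (∃[ t′ ] t′ < t × Ends v t′ ⟨ encodeᵛ zs , k ⟩)
  encode*-sound [] xs k t ends with t′ , t′<t , ends′ ← Ends-exec 0 t ends =
    [] , tt , t′ , t′<t , ends′
  encode*-sound (g ∷ gs) xs k t ends
    with t₁ , t₁<t , ends₁ ← Ends-exec 5 t ends
    with z , p , t₂ , t₂<t₁ , ends₂ ← encode-sound g xs _ t₁ ends₁
    with t₃ , t₃<t₂ , ends₃ ← Ends-exec 8 t₂ ends₂
    with zs , q , t₄ , t₄<t₃ , ends₄ ← encode*-sound gs xs _ t₃ ends₃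
    with t₅ , t₅<t₄ , ends₅ ← Ends-exec 9 t₄ ends₄ =
    z ∷ zs , (p , q) , t₅ ,
    <-trans t₅<t₄ (<-trans t₄<t₃ (<-trans t₃<t₂ (<-trans t₂<t₁ t₁<t))) , ends₅

run-universal : (c : Rec n) (xs : Vec ℕ n) (y : ℕ) →
                Eval c xs y ⇔ (λ t → run t (encode c) (encodeᵛ xs)) ↓ y
run-universal c xs y = mk⇔ to from
  where
  to : Eval c xs y → (λ t → run t (encode c) (encodeᵛ xs)) ↓ y
  to p with t , eq ← encode-run c xs p 0 = t , trans (cong output eq) (output-⟨,⟩ y)
  from : (λ t → run t (encode c) (encodeᵛ xs)) ↓ y → Eval c xs y
  from (t , eq)
    with z , p , t′ , _ , mkEnds ends ← encode-sound c xs 0 t (mkEnds (output-halted _ y eq))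
    -- A halted machine stays put, so the value left on the empty stack is the output.
    with refl , _ ← ⟨,⟩-injective (trans (sym (steps-halted t′ z)) ends) = p

-- Conditions coded as numbers

∑-zero : ∀ n {f} → ∑ n f ≡ 0 → ∀ i → i < n → f i ≡ 0
∑-zero (suc n) {f} eq i i<1+n with m<1+n⇒m<n∨m≡n i<1+n
... | inj₁ i<n  = ∑-zero n (m+n≡0⇒m≡0 (∑ n f) eq) i i<n
... | inj₂ refl = m+n≡0⇒n≡0 (∑ n f) eq

zero-∑ : ∀ n {f} → (∀ i → i < n → f i ≡ 0) → ∑ n f ≡ 0
zero-∑ zero    f≡0 = refl
zero-∑ (suc n) f≡0 = cong₂ _+_ (zero-∑ n λ i i<n → f≡0 i (m<n⇒m<1+n i<n)) (f≡0 n (n<1+n n))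

∑-nonzero : ∀ n {f} → ∑ n f ≢ 0 → ∃[ i ] i < n × f i ≢ 0
∑-nonzero zero    ∑≢0 = contradiction refl ∑≢0
∑-nonzero (suc n) {f} ∑≢0 with f n ≟ 0
... | no  fn≢0 = n , n<1+n n , fn≢0
... | yes fn≡0 with i , i<n , fi≢0 ← ∑-nonzero n (λ ∑≡0 → ∑≢0 (cong₂ _+_ ∑≡0 fn≡0)) =
  i , m<n⇒m<1+n i<n , fi≢0

nonzero-∑ : ∀ n {f} i → i < n → f i ≢ 0 → ∑ n f ≢ 0
nonzero-∑ n i i<n fi≢0 ∑≡0 = fi≢0 (∑-zero n ∑≡0 i i<n)

neg≡0⇒≢0 : ∀ {a} → neg a ≡ 0 → a ≢ 0
neg≡0⇒≢0 {suc a} _ ()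

≢0⇒neg≡0 : ∀ {a} → a ≢ 0 → neg a ≡ 0
≢0⇒neg≡0 {zero}  a≢0 = contradiction refl a≢0
≢0⇒neg≡0 {suc a} _   = refl

neg≢0⇒≡0 : ∀ {a} → neg a ≢ 0 → a ≡ 0
neg≢0⇒≡0 {zero}  _     = refl
neg≢0⇒≡0 {suc a} neg≢0 = contradiction refl neg≢0

≡suc⇒≢0 : ∀ {a v} → a ≡ suc v → a ≢ 0
≡suc⇒≢0 refl ()

≢0⇒≡suc : ∀ {a} → a ≢ 0 → a ≡ suc (pred a)
≢0⇒≡suc {zero}  a≢0 = contradiction refl a≢0
≢0⇒≡suc {suc a} _   = refl

∣-∣≢0⇒≢ : ∀ {a b} → ∣ a - b ∣ ≢ 0 → a ≢ b
∣-∣≢0⇒≢ dist≢0 eq = dist≢0 (m≡n⇒∣m-n∣≡0 eq)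

≢⇒∣-∣≢0 : ∀ {a b} → a ≢ b → ∣ a - b ∣ ≢ 0
≢⇒∣-∣≢0 a≢b dist≡0 = a≢b (∣m-n∣≡0⇒m≡n dist≡0)

m+m≤n+n⇒m≤n : ∀ {m n} → m + m ≤ n + n → m ≤ n
m+m≤n+n⇒m≤n {m} {n} le with m ≤? n
... | yes m≤n = m≤n
... | no  m≰n = contradiction (<-≤-trans (+-mono-< (≰⇒> m≰n) (≰⇒> m≰n)) le) (<-irrefl refl)

-- Equality of limit functions, and the domains {0, ..., 2n}

infix 4 _≃_

_≃_ : (f g : ℕ → ℕ → ℕ) → Set
f ≃ g = ∀ y v → (λ t → f t y) ↓ v ⇔ (λ t → g t y) ↓ v

≃-refl : ∀ {f} → f ≃ f
≃-refl y v = mk⇔ id id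

≃-sym : ∀ {f g} → f ≃ g → g ≃ f
≃-sym f≃g y v = ⇔-sym (f≃g y v)

≃-trans : ∀ {f g h} → f ≃ g → g ≃ h → f ≃ h
≃-trans f≃g g≃h y v = g≃h y v ⇔-∘ f≃g y v

Persistent₂ : (ℕ → ℕ → ℕ) → Set
Persistent₂ f = ∀ y → Persistent (λ t → f t y)

eventually-≃ : ∀ {f g} → Persistent₂ f → Persistent₂ g → ∀ T →
               (∀ t → T ≤ t → ∀ y → f t y ≡ g t y) → f ≃ g
eventually-≃ f-persistent g-persistent T f≡g y v = mk⇔
  (λ { (t , eq) → t ⊔ T , trans (sym (f≡g (t ⊔ T) (m≤n⊔m t T) y))
                                (persists (f-persistent y) (m≤m⊔n t T) eq) })
  (λ { (t , eq) → t ⊔ T , trans (f≡g (t ⊔ T) (m≤n⊔m t T) y)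
                                (persists (g-persistent y) (m≤m⊔n t T) eq) })

Defined : (ℕ → ℕ → ℕ) → ℕ → Set
Defined f y = ∃[ v ] (λ t → f t y) ↓ v

Defined-resp-≃ : ∀ {f g} → f ≃ g → ∀ {y} → Defined f y → Defined g y
Defined-resp-≃ f≃g {y} (v , fy↓v) = v , Equivalence.to (f≃g y v) fy↓v

-- Named after the odd size of {0, ..., 2n}.
OddSegment : (ℕ → ℕ → ℕ) → ℕ → Set
OddSegment f n = ∀ y → Defined f y ⇔ y ≤ n + n

OddSegment-resp-≃ : ∀ {f g n} → f ≃ g → OddSegment f n → OddSegment g n
OddSegment-resp-≃ {f} {g} f≃g segment y = mk⇔
  (Equivalence.to (segment y) ∘ Defined-resp-≃ {g} {f} (≃-sym f≃g))
  (Defined-resp-≃ {f} {g} f≃g ∘ Equivalence.from (segment y))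

OddSegment-unique : ∀ {f m n} → OddSegment f m → OddSegment f n → m ≡ n
OddSegment-unique {m = m} {n} segₘ segₙ = ≤-antisym
  (m+m≤n+n⇒m≤n (Equivalence.to (segₙ (m + m)) (Equivalence.from (segₘ (m + m)) ≤-refl)))
  (m+m≤n+n⇒m≤n (Equivalence.to (segₘ (n + n)) (Equivalence.from (segₙ (n + n)) ≤-refl)))

-- The standard numbering `φ` by stages

opaque

  -- Stage t shows only arguments below t. So what a worker has shown when it dies fits into some
  -- {0, ..., 2n}, and hits of a range need only be sought below the stage.
  φ : ℕ → ℕ → ℕ → ℕ
  φ t i y = ifz (suc y ∸ t) (run t i ⟨ y , 0 ⟩) 0

  φ-total : Total 3 φ
  φ-total = explicit (ifz-total · (∸-total · (suc-total · # 2F ∷ []) ∷ # 0F ∷ []) ∷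
      (run-total · # 0F ∷ # 1F ∷ (⟨,⟩-total · # 2F ∷ lit 0 ∷ []) ∷ []) ∷ lit 0 ∷ [])
    λ { (_ ∷ _ ∷ _ ∷ []) → refl }

  φ-bounded : ∀ t i y → t ≤ y → φ t i y ≡ 0
  φ-bounded t i y t≤y = ifz-no (m>n⇒m∸n≢0 (s≤s t≤y))

  φ-run : ∀ t i y → y < t → φ t i y ≡ run t i ⟨ y , 0 ⟩
  φ-run t i y y<t = ifz-yes (m≤n⇒m∸n≡0 y<t)

φ-defined⇒< : ∀ {t i y v} → φ t i y ≡ suc v → y < t
φ-defined⇒< {t} {i} {y} eq with y <? t
... | yes y<t = y<t
... | no  y≮t = contradiction (φ-bounded t i y (≮⇒≥ y≮t)) (≡suc⇒≢0 eq)

φ-persistent : ∀ i → Persistent₂ (λ t → φ t i)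
φ-persistent i y t v eq = trans (φ-run (suc t) i y (m<n⇒m<1+n y<t))
  (run-persistent i ⟨ y , 0 ⟩ t v (trans (sym (φ-run t i y y<t)) eq))
  where
  y<t : y < t
  y<t = φ-defined⇒< eq

φ-universal : (c : Rec 1) (y v : ℕ) → Eval c (y ∷ []) v ⇔ (λ t → φ t (encode c) y) ↓ v
φ-universal c y v = mk⇔
  (λ p → case Equivalence.to (run-universal c (y ∷ []) v) p of λ { (t , eq) →
    t ⊔ suc y , trans (φ-run (t ⊔ suc y) (encode c) y (m≤n⊔m t (suc y)))
      (persists (run-persistent (encode c) ⟨ y , 0 ⟩) (m≤m⊔n t (suc y)) eq) })
  (λ { (t , eq) → Equivalence.from (run-universal c (y ∷ []) v)
    (t , trans (sym (φ-run t (encode c) y (φ-defined⇒< eq))) eq) })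

-- χ numbers the partial computable functions whose domain is not of the
-- form {0, …, 2n}: an index ⟨ i , ⟨ g , z ⟩ ⟩ with g < z forces a gap at g
-- below the domain element z, any other index only shows complete pairs
-- of an initial segment.

odd : ℕ → ℕ
odd zero    = 0
odd (suc n) = neg (odd n)

odd-total : Total 1 odd
odd-total = recursive (lit 0) (neg-total · # 1F ∷ []) (λ { [] → refl }) (λ { m [] → refl })

odd-double : ∀ n → odd (n + n) ≡ 0
odd-double zero    = refl
odd-double (suc n) rewrite +-suc n n | odd-double n = refl

halve : ∀ y → ∃[ n ] (y ≡ n + n ⊎ y ≡ suc (n + n))
halve zero = 0 , inj₁ refl
halve (suc y) with halve y
... | n , inj₁ eq = n , inj₂ (cong suc eq)
... | n , inj₂ eq = suc n , inj₁ (cong suc (trans eq (sym (+-suc n n))))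

-- `odd` is 1 on odd numbers, so this is the odd element of the pair {2n, 2n+1} containing `y`.
pairTop : ℕ → ℕ
pairTop y = y + neg (odd y)

pairTop-even : ∀ n → pairTop (n + n) ≡ suc (n + n)
pairTop-even n rewrite odd-double n = +-comm (n + n) 1

pairTop-odd : ∀ n → pairTop (suc (n + n)) ≡ suc (n + n)
pairTop-odd n rewrite odd-double n = +-identityʳ (suc (n + n))

undefineds : ℕ → ℕ → ℕ → ℕ
undefineds n t i = ∑ n (λ y → neg (φ t i y))

undefineds-total : Total 3 undefineds
undefineds-total = ∑-total {f = λ y t i → neg (φ t i y)}
  (explicit (neg-total · (φ-total · # 1F ∷ # 2F ∷ # 0F ∷ []) ∷ []) λ { (_ ∷ _ ∷ _ ∷ []) → refl })

gapped : (t i g z y : ℕ) → ℕ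
gapped t i g z y = ifz ∣ y - g ∣ 0 (ifz (φ t i z) 0 (φ t i y))

paired : (t i y : ℕ) → ℕ
paired t i y = ifz (undefineds (suc (pairTop y)) t i) (φ t i y) 0

χ′ : (t i g z y : ℕ) → ℕ
χ′ t i g z y = ifz (suc g ∸ z) (gapped t i g z y) (paired t i y)

opaque

  χ : ℕ → ℕ → ℕ → ℕ
  χ t j y = χ′ t (π₁ j) (π₁ (π₂ j)) (π₂ (π₂ j)) y

  χ-≡ : ∀ t j y → χ t j y ≡ χ′ t (π₁ j) (π₁ (π₂ j)) (π₂ (π₂ j)) y
  χ-≡ t j y = refl

  χ-total : Total 3 χ
  χ-total = explicit
    (ifz-total · (∸-total · (suc-total · g ∷ []) ∷ z ∷ []) ∷
      (ifz-total · (∣-∣-total · y ∷ g ∷ []) ∷ lit 0 ∷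
        (ifz-total · (φ-total · t ∷ i ∷ z ∷ []) ∷ lit 0 ∷ (φ-total · t ∷ i ∷ y ∷ []) ∷ []) ∷ []) ∷
      (ifz-total · (undefineds-total ·
          (suc-total · (+-total · y ∷ (neg-total · (odd-total · y ∷ []) ∷ []) ∷ []) ∷ []) ∷
          t ∷ i ∷ []) ∷
        (φ-total · t ∷ i ∷ y ∷ []) ∷ lit 0 ∷ []) ∷ [])
    λ { (_ ∷ _ ∷ _ ∷ []) → refl }
    where
    t i g z y : Term 3
    t = # 0F
    i = π₁-total · # 1F ∷ []
    g = π₁-total · (π₂-total · # 1F ∷ []) ∷ []
    z = π₂-total · (π₂-total · # 1F ∷ []) ∷ []
    y = # 2F

χ-⟨,⟩ : ∀ t i g z y → χ t ⟨ i , ⟨ g , z ⟩ ⟩ y ≡ χ′ t i g z y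
χ-⟨,⟩ t i g z y rewrite χ-≡ t ⟨ i , ⟨ g , z ⟩ ⟩ y
  | π₁-⟨,⟩ i ⟨ g , z ⟩ | π₂-⟨,⟩ i ⟨ g , z ⟩ | π₁-⟨,⟩ g z | π₂-⟨,⟩ g z = refl

gapped-≡ : ∀ {t i g z y v} → gapped t i g z y ≡ suc v →
           y ≢ g × φ t i z ≢ 0 × φ t i y ≡ suc v
gapped-≡ {t} {i} {g} {z} {y} eq with ∣ y - g ∣ in y≢g | φ t i z
... | suc _ | suc _ = ∣-∣≢0⇒≢ (≡suc⇒≢0 y≢g) , (λ ()) , eq

≡-gapped : ∀ {t i g z y v} → y ≢ g → φ t i z ≢ 0 → φ t i y ≡ suc v → gapped t i g z y ≡ suc v
≡-gapped y≢g z↓ eq = trans (ifz-no (≢⇒∣-∣≢0 y≢g)) (trans (ifz-no z↓) eq)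

paired-≡ : ∀ {t i y v} → paired t i y ≡ suc v →
           (∀ x → x ≤ pairTop y → φ t i x ≢ 0) × φ t i y ≡ suc v
paired-≡ {t} {i} {y} eq with undefineds (suc (pairTop y)) t i in all↓
... | zero = (λ x x≤ → neg≡0⇒≢0 (∑-zero (suc (pairTop y)) all↓ x (s≤s x≤))) , eq

≡-paired : ∀ {t i y v} → (∀ x → x ≤ pairTop y → φ t i x ≢ 0) → φ t i y ≡ suc v →
           paired t i y ≡ suc v
≡-paired {y = y} all↓ eq = trans
  (ifz-yes (zero-∑ (suc (pairTop y)) λ x x< → ≢0⇒neg≡0 (all↓ x (≤-pred x<)))) eq

φ-persistent-≢0 : ∀ {t i y} → φ t i y ≢ 0 → φ (suc t) i y ≢ 0
φ-persistent-≢0 {t} {i} {y} ≢0 = ≡suc⇒≢0 (φ-persistent i y t _ (≢0⇒≡suc ≢0))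

χ′-φ : ∀ t i g z y {v} → χ′ t i g z y ≡ suc v → φ t i y ≡ suc v
χ′-φ t i g z y eq with suc g ∸ z
... | zero  = proj₂ (proj₂ (gapped-≡ {t} {i} {g} {z} {y} eq))
... | suc _ = proj₂ (paired-≡ {t} {i} {y} eq)

χ-φ : ∀ t j y {v} → χ t j y ≡ suc v → φ t (π₁ j) y ≡ suc v
χ-φ t j y eq = χ′-φ t (π₁ j) (π₁ (π₂ j)) (π₂ (π₂ j)) y (trans (sym (χ-≡ t j y)) eq)

χ-defined⇒< : ∀ {t j y v} → χ t j y ≡ suc v → y < t
χ-defined⇒< {t} {j} {y} eq = φ-defined⇒< (χ-φ t j y eq)

χ-bounded : ∀ t j y → t ≤ y → χ t j y ≡ 0
χ-bounded t j y t≤y with χ t j y in eq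
... | zero  = refl
... | suc _ = contradiction (χ-defined⇒< eq) (≤⇒≯ t≤y)

χ′-persistent : ∀ i g z → Persistent₂ (λ t → χ′ t i g z)
χ′-persistent i g z y t v eq with suc g ∸ z
... | zero  = let y≢g , z↓ , y↓ = gapped-≡ {t} {i} {g} {z} {y} eq in
  ≡-gapped {suc t} {i} {g} {z} {y} y≢g (φ-persistent-≢0 {t} {i} z↓) (φ-persistent i y t v y↓)
... | suc _ = let all↓ , y↓ = paired-≡ {t} {i} {y} eq in
  ≡-paired {suc t} {i} {y} (λ x x≤ → φ-persistent-≢0 {t} {i} (all↓ x x≤)) (φ-persistent i y t v y↓)

χ-persistent : ∀ j → Persistent₂ (λ t → χ t j)
χ-persistent j y t v eq = trans (χ-≡ (suc t) j y)
  (χ′-persistent (π₁ j) (π₁ (π₂ j)) (π₂ (π₂ j)) y t v (trans (sym (χ-≡ t j y)) eq))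

n≤n+n : ∀ n → n ≤ n + n
n≤n+n n = m≤m+n n n

-- In the gapped case 0 is shown, which requires `φ i` to be defined at `z`; then `z` is shown as
-- well, so the segment would contain the suppressed `g < z`. In the paired case 2n is shown only
-- together with 2n+1.
χ′-not-OddSegment : ∀ i g z n → ¬ OddSegment (λ t → χ′ t i g z) n
χ′-not-OddSegment i g z n segment with suc g ∸ z in g<z
... | zero
  with v , t , eq ← Equivalence.from (segment 0) z≤n
  with y≢g , z↓ , _ ← gapped-≡ {t} {i} {g} {z} {0} eq
  with z≤2n ← Equivalence.to (segment z) (_ , t , ≡-gapped {t} {i} {g} {z} {z}
    (λ { refl → 1+n≰n (m∸n≡0⇒m≤n {suc z} {z} g<z) }) z↓ (≢0⇒≡suc z↓))
  with w , u , eq′ ← Equivalence.from (segment g) (≤-trans (<⇒≤ (m∸n≡0⇒m≤n g<z)) z≤2n) =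
  proj₁ (gapped-≡ {u} {i} {g} {z} {g} eq′) refl
... | suc _
  with v , t , eq ← Equivalence.from (segment (n + n)) ≤-refl
  with all↓ , _ ← paired-≡ {t} {i} {n + n} eq =
  contradiction (Equivalence.to (segment (suc (n + n))) (_ , t ,
      ≡-paired {t} {i} {suc (n + n)}
        (λ x x≤ → all↓ x (subst (x ≤_) (trans (pairTop-odd n) (sym (pairTop-even n))) x≤))
        (≢0⇒≡suc (all↓ (suc (n + n)) (≤-reflexive (sym (pairTop-even n)))))))
    (<-irrefl refl)

χ-≃-χ′ : ∀ j → (λ t → χ t j) ≃ (λ t → χ′ t (π₁ j) (π₁ (π₂ j)) (π₂ (π₂ j)))
χ-≃-χ′ j = eventually-≃ (χ-persistent j) (χ′-persistent (π₁ j) (π₁ (π₂ j)) (π₂ (π₂ j))) 0 λ t _ y → χ-≡ t j y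

χ-not-OddSegment : ∀ j n → ¬ OddSegment (λ t → χ t j) n
χ-not-OddSegment j n segment =
  χ′-not-OddSegment (π₁ j) (π₁ (π₂ j)) (π₂ (π₂ j)) n
    (OddSegment-resp-≃ {n = n} (χ-≃-χ′ j) segment)

-- Guessing where χ j first differs from all its predecessors

distance : ℕ → ℕ → ℕ → ℕ → ℕ
distance w t k j = ∑ w (λ y → ∣ χ t k y - χ t j y ∣)

clash : ℕ → ℕ → ℕ → ℕ
clash j w t = ∑ j (λ k → neg (distance w t k j))

-- The guess is the length below which χ j has differed from each χ k with
-- k < j ever since the guess was made; it converges iff j is the least
-- index of its function.
guess : ℕ → ℕ → ℕ
guess zero    j = 0
guess (suc t) j = ifz (clash j (guess t j) t) (guess t j) (suc t)

-- A dead worker keeps the approximation of `χ j` from this stage. The default 0 covers lengths that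
-- are never guessed.
lastAlive : ℕ → ℕ → ℕ → ℕ
lastAlive zero    j s = 0
lastAlive (suc t) j s = ifz ∣ guess (suc t) j - s ∣ (suc t) (lastAlive t j s)

distance-total : Total 4 distance
distance-total = ∑-total {f = λ y t k j → ∣ χ t k y - χ t j y ∣} (explicit
  (∣-∣-total · (χ-total · # 1F ∷ # 2F ∷ # 0F ∷ []) ∷ (χ-total · # 1F ∷ # 3F ∷ # 0F ∷ []) ∷ [])
  λ { (_ ∷ _ ∷ _ ∷ _ ∷ []) → refl })

clash-total : Total 3 clash
clash-total = explicit (clash′ · # 0F ∷ # 1F ∷ # 2F ∷ # 0F ∷ []) λ { (_ ∷ _ ∷ _ ∷ []) → refl }
  where
  clash′ : Total 4 (λ i w t j → ∑ i (λ k → neg (distance w t k j)))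
  clash′ = ∑-total {f = λ k w t j → neg (distance w t k j)} (explicit
    (neg-total · (distance-total · # 1F ∷ # 2F ∷ # 0F ∷ # 3F ∷ []) ∷ [])
    λ { (_ ∷ _ ∷ _ ∷ _ ∷ []) → refl })

guess-total : Total 2 guess
guess-total = recursive (lit 0)
  (ifz-total · (clash-total · # 2F ∷ # 1F ∷ # 0F ∷ []) ∷ # 1F ∷ (suc-total · # 0F ∷ []) ∷ [])
  (λ { (_ ∷ []) → refl }) (λ { m (_ ∷ []) → refl })

lastAlive-total : Total 3 lastAlive
lastAlive-total = recursive (lit 0)
  (ifz-total ·
    (∣-∣-total · (guess-total · (suc-total · # 0F ∷ []) ∷ # 2F ∷ []) ∷ # 3F ∷ []) ∷
    (suc-total · # 0F ∷ []) ∷ # 1F ∷ [])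
  (λ { (_ ∷ _ ∷ []) → refl }) (λ { m (_ ∷ _ ∷ []) → refl })

guess-step : ∀ t j → guess (suc t) j ≡ guess t j ⊎ guess (suc t) j ≡ suc t
guess-step t j with clash j (guess t j) t
... | zero  = inj₁ refl
... | suc _ = inj₂ refl

guess≤ : ∀ t j → guess t j ≤ t
guess≤ zero    j = z≤n
guess≤ (suc t) j with guess-step t j
... | inj₁ eq = ≤-trans (≤-reflexive eq) (m≤n⇒m≤1+n (guess≤ t j))
... | inj₂ eq = ≤-reflexive eq

-- Every new guess is the current stage, so from stage `s` on an abandoned length `s` cannot return.
-- This makes the death of a worker final.
guess-stays-away : ∀ t j s → s ≤ t → guess t j ≢ s → guess (suc t) j ≢ s
guess-stays-away t j s s≤t away eq with guess-step t j
... | inj₁ same = away (trans (sym same) eq)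
... | inj₂ new  = 1+n≰n (≤-trans (≤-reflexive (trans (sym new) eq)) s≤t)

lastAlive-alive : ∀ t j s → guess t j ≡ s → lastAlive t j s ≡ t
lastAlive-alive zero    j s eq = refl
lastAlive-alive (suc t) j s eq = ifz-yes (m≡n⇒∣m-n∣≡0 eq)

lastAlive-dead : ∀ t j s → guess (suc t) j ≢ s → lastAlive (suc t) j s ≡ lastAlive t j s
lastAlive-dead t j s dead = ifz-no (≢⇒∣-∣≢0 dead)

-- Tokens: group x consists of the indices token x m with m ≤ 2^x.  The
-- state of a token records which of the first x ranges it has entered;
-- whenever the state of some member changes, the whole group moves to
-- fresh positions, which tell members apart exactly by their states.

tokenCode : ℕ → ℕ → ℕ
tokenCode x m = ⟨ 0 , ⟨ x , m ⟩ ⟩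

-- Unlike the coded conditions, 1 means true here: this is a binary digit, and `state` assembles the
-- digits of the first ranges into a number.
entered : ℕ → ℕ → ℕ → ℕ
entered u e p = neg (neg (∑ u (λ n → neg ∣ φ u e n - suc p ∣)))

state : ℕ → ℕ → ℕ → ℕ
state zero    u p = 0
state (suc e) u p = state e u p + state e u p + entered u e p

tokenState : ℕ → ℕ → ℕ → ℕ
tokenState u x m = state x u (tokenCode x m)

change : ℕ → ℕ → ℕ
change u x = ∑ (suc (2 ^ x)) (λ m → ∣ tokenState (suc u) x m - tokenState u x m ∣)

lastChange : ℕ → ℕ → ℕ
lastChange zero    x = 0
lastChange (suc u) x = ifz (change u x) (lastChange u x) (suc u)

position : ℕ → ℕ → ℕ → ℕ
position u x m = lastChange u x * 2 ^ x + tokenState u x m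

tokenCode-total : Total 2 tokenCode
tokenCode-total = explicit (⟨,⟩-total · lit 0 ∷ (⟨,⟩-total · # 0F ∷ # 1F ∷ []) ∷ [])
  λ { (_ ∷ _ ∷ []) → refl }

entered-total : Total 3 entered
entered-total = explicit
  (neg-total · (neg-total · (hits · # 0F ∷ # 0F ∷ # 1F ∷ # 2F ∷ []) ∷ []) ∷ [])
  λ { (_ ∷ _ ∷ _ ∷ []) → refl }
  where
  hits : Total 4 (λ b u e p → ∑ b (λ n → neg ∣ φ u e n - suc p ∣))
  hits = ∑-total {f = λ n u e p → neg ∣ φ u e n - suc p ∣} (explicit
    (neg-total · (∣-∣-total · (φ-total · # 1F ∷ # 2F ∷ # 0F ∷ []) ∷
                              (suc-total · # 3F ∷ []) ∷ []) ∷ [])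
    λ { (_ ∷ _ ∷ _ ∷ _ ∷ []) → refl })

state-total : Total 3 state
state-total = recursive (lit 0)
  (+-total · (+-total · # 1F ∷ # 1F ∷ []) ∷ (entered-total · # 2F ∷ # 0F ∷ # 3F ∷ []) ∷ [])
  (λ { (_ ∷ _ ∷ []) → refl }) (λ { m (_ ∷ _ ∷ []) → refl })

tokenState-total : Total 3 tokenState
tokenState-total = explicit
  (state-total · # 1F ∷ # 0F ∷ (tokenCode-total · # 1F ∷ # 2F ∷ []) ∷ [])
  λ { (_ ∷ _ ∷ _ ∷ []) → refl }

change-total : Total 2 change
change-total = explicit
  (changes · (suc-total · (2^-total · # 1F ∷ []) ∷ []) ∷ # 0F ∷ # 1F ∷ [])
  λ { (_ ∷ _ ∷ []) → refl }
  where
  changes : Total 3 (λ b u x → ∑ b (λ m → ∣ tokenState (suc u) x m - tokenState u x m ∣))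
  changes = ∑-total {f = λ m u x → ∣ tokenState (suc u) x m - tokenState u x m ∣} (explicit
    (∣-∣-total · (tokenState-total · (suc-total · # 1F ∷ []) ∷ # 2F ∷ # 0F ∷ []) ∷
                 (tokenState-total · # 1F ∷ # 2F ∷ # 0F ∷ []) ∷ [])
    λ { (_ ∷ _ ∷ _ ∷ []) → refl })

lastChange-total : Total 2 lastChange
lastChange-total = recursive (lit 0)
  (ifz-total · (change-total · # 0F ∷ # 2F ∷ []) ∷ # 1F ∷ (suc-total · # 0F ∷ []) ∷ [])
  (λ { (_ ∷ []) → refl }) (λ { m (_ ∷ []) → refl })

position-total : Total 3 position
position-total = explicit
  (+-total · (*-total · (lastChange-total · # 0F ∷ # 1F ∷ []) ∷ (2^-total · # 1F ∷ []) ∷ []) ∷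
             (tokenState-total · # 0F ∷ # 1F ∷ # 2F ∷ []) ∷ [])
  λ { (_ ∷ _ ∷ _ ∷ []) → refl }

-- States as binary numbers, and freshness of positions

bit≤1 : ∀ a → neg a ≤ 1
bit≤1 zero    = ≤-refl
bit≤1 (suc a) = z≤n

double : ∀ n → n + n ≡ 2 * n
double n = cong (n +_) (sym (+-identityʳ n))

state< : ∀ e u p → state e u p < 2 ^ e
state< zero    u p = s≤s z≤n
state< (suc e) u p = begin-strict
  s + s + entered u e p  ≤⟨ +-monoʳ-≤ (s + s) (bit≤1 _) ⟩
  s + s + 1              ≡⟨ +-comm (s + s) 1 ⟩
  suc (s + s)            <⟨ s≤s (≤-reflexive (sym (+-suc s s))) ⟩
  suc s + suc s          ≤⟨ +-mono-≤ (state< e u p) (state< e u p) ⟩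
  2 ^ e + 2 ^ e          ≡⟨ double (2 ^ e) ⟩
  2 ^ suc e              ∎
  where
  open ≤-Reasoning
  s : ℕ
  s = state e u p

neg-cases : ∀ a → neg a ≡ 0 ⊎ neg a ≡ 1
neg-cases zero    = inj₂ refl
neg-cases (suc a) = inj₁ refl

double-bit-injective : ∀ {a b c d} → (c ≡ 0 ⊎ c ≡ 1) → (d ≡ 0 ⊎ d ≡ 1) →
                       a + a + c ≡ b + b + d → a ≡ b × c ≡ d
double-bit-injective {a} {b} (inj₁ refl) (inj₁ refl) eq
  rewrite +-identityʳ (a + a) | +-identityʳ (b + b) = half-injective a b eq , refl
  where
  half-injective : ∀ a b → a + a ≡ b + b → a ≡ b
  half-injective a b eq = ≤-antisym (m+m≤n+n⇒m≤n (≤-reflexive eq))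
                                    (m+m≤n+n⇒m≤n (≤-reflexive (sym eq)))
double-bit-injective {a} {b} (inj₂ refl) (inj₂ refl) eq =
  proj₁ (double-bit-injective (inj₁ refl) (inj₁ refl)
    (cong (_+ 0) (+-cancelʳ-≡ 1 (a + a) (b + b) eq))) , refl
double-bit-injective {a} {b} (inj₁ refl) (inj₂ refl) eq =
  contradiction (trans (sym (odd-double a)) (trans (cong odd (trans
    (sym (+-identityʳ (a + a))) (trans eq (+-comm (b + b) 1)))) (cong neg (odd-double b)))) λ ()
double-bit-injective {a} {b} (inj₂ refl) (inj₁ refl) eq =
  contradiction (trans (sym (odd-double b)) (trans (cong odd (trans
    (sym (+-identityʳ (b + b))) (trans (sym eq) (+-comm (a + a) 1)))) (cong neg (odd-double a)))) λ ()

state-injective : ∀ x u p q → state x u p ≡ state x u q →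
                  ∀ e → e < x → entered u e p ≡ entered u e q
state-injective (suc x) u p q eq e e<1+x
  with same , last ← double-bit-injective {state x u p} {state x u q}
    (neg-cases _) (neg-cases _) eq
  with m<1+n⇒m<n∨m≡n e<1+x
... | inj₁ e<x  = state-injective x u p q same e e<x
... | inj₂ refl = last

entered-intro : ∀ u e p n → φ u e n ≡ suc p → entered u e p ≡ 1
entered-intro u e p n eq
  with ∑ u (λ n → neg ∣ φ u e n - suc p ∣) in sum
... | suc _ = refl
... | zero  = contradiction (∑-zero u sum n (φ-defined⇒< eq))
  λ neg≡0 → neg≡0⇒≢0 neg≡0 (m≡n⇒∣m-n∣≡0 eq)

entered-elim : ∀ u e p → entered u e p ≢ 0 → ∃[ n ] n < u × φ u e n ≡ suc p
entered-elim u e p entered≢0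
  with n , n<u , hit ← ∑-nonzero u (neg≡0⇒≢0 (neg≢0⇒≡0 entered≢0)) =
  n , n<u , ∣m-n∣≡0⇒m≡n (neg≢0⇒≡0 hit)

entered-mono : ∀ u e p → entered u e p ≤ entered (suc u) e p
entered-mono u e p with entered u e p ≟ 0
... | yes eq = ≤-trans (≤-reflexive eq) z≤n
... | no  ≢0 with n , n<u , hit ← entered-elim u e p ≢0 =
  ≤-trans (bit≤1 _) (≤-reflexive (sym (entered-intro (suc u) e p n (φ-persistent e n u p hit))))

state-mono : ∀ e u p → state e u p ≤ state e (suc u) p
state-mono zero    u p = z≤n
state-mono (suc e) u p =
  +-mono-≤ (+-mono-≤ (state-mono e u p) (state-mono e u p)) (entered-mono u e p)

lastChange≤ : ∀ u x → lastChange u x ≤ u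
lastChange≤ zero    x = z≤n
lastChange≤ (suc u) x with change u x
... | zero  = m≤n⇒m≤1+n (lastChange≤ u x)
... | suc _ = ≤-refl

position-step : ∀ u x → (∀ m → m ≤ 2 ^ x → position (suc u) x m ≡ position u x m) ⊎
                        (∀ m → suc u * 2 ^ x ≤ position (suc u) x m)
position-step u x with change u x in changed
... | suc _ = inj₂ λ m → m≤m+n (suc u * 2 ^ x) _
... | zero  = inj₁ λ m m≤ → cong (lastChange u x * 2 ^ x +_)
  (∣m-n∣≡0⇒m≡n (∑-zero (suc (2 ^ x)) changed m (s≤s m≤)))

position< : ∀ u x m → position u x m < suc u * 2 ^ x
position< u x m = begin-strict
  lastChange u x * 2 ^ x + tokenState u x m  <⟨ +-monoʳ-< _ (state< x u (tokenCode x m)) ⟩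
  lastChange u x * 2 ^ x + 2 ^ x             ≡⟨ +-comm _ (2 ^ x) ⟩
  suc (lastChange u x) * 2 ^ x               ≤⟨ *-monoˡ-≤ (2 ^ x) (s≤s (lastChange≤ u x)) ⟩
  suc u * 2 ^ x                              ∎
  where open ≤-Reasoning

position-mono : ∀ u x m → m ≤ 2 ^ x → position u x m ≤ position (suc u) x m
position-mono u x m m≤ with position-step u x
... | inj₁ same  = ≤-reflexive (sym (same m m≤))
... | inj₂ fresh = <⇒≤ (<-≤-trans (position< u x m) (fresh m))

Vacant : ℕ → ℕ → ℕ → Set
Vacant u x n = ∀ m → m ≤ 2 ^ x → position u x m ≢ n

-- A moving group lands at or above `suc u * 2 ^ x`, beyond every `n ≤ u`. Vacancy at one such stage
-- is therefore a permanent certificate.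
vacant-step : ∀ u x n → n ≤ u → Vacant u x n → Vacant (suc u) x n
vacant-step u x n n≤u vacant m m≤ with position-step u x
... | inj₁ same  = λ eq → vacant m m≤ (trans (sym (same m m≤)) eq)
... | inj₂ fresh = λ eq → <-irrefl refl (begin-strict
  n                   ≤⟨ n≤u ⟩
  u                   <⟨ n<1+n u ⟩
  suc u               ≤⟨ m≤m*n (suc u) (2 ^ x) {{m^n≢0 2 x}} ⟩
  suc u * 2 ^ x       ≤⟨ fresh m ⟩
  position (suc u) x m ≡⟨ eq ⟩
  n                   ∎)
  where open ≤-Reasoning

vacant-forever : ∀ {u u′} x n → n ≤ u → u ≤ u′ → Vacant u x n → Vacant u′ x n
vacant-forever x n n≤u u≤u′ vacant = go (≤⇒≤′ u≤u′)
  where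
  go : ∀ {u′} → _ ≤′ u′ → Vacant u′ x n
  go ≤′-refl       = vacant
  go (≤′-step u≤′) = vacant-step _ x n (≤-trans n≤u (≤′⇒≤ u≤′)) (go u≤′)

-- The numbering ψ

data Index : Set where
  token     : (x m : ℕ) → Index
  worker    : (j s : ℕ) → Index
  canonical : (i t n w : ℕ) → Index

decodeTagged : ℕ → ℕ → Index
decodeTagged 0             a = token (π₁ a) (π₂ a)
decodeTagged 1             a = worker (π₁ a) (π₂ a)
decodeTagged (suc (suc _)) a =
  canonical (π₁ a) (π₁ (π₂ a)) (π₁ (π₂ (π₂ a))) (π₂ (π₂ (π₂ a)))

decode : ℕ → Index
decode p = decodeTagged (π₁ p) (π₂ p)

encodeIndex : Index → ℕ
encodeIndex (token x m)         = tokenCode x m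
encodeIndex (worker j s)        = ⟨ 1 , ⟨ j , s ⟩ ⟩
encodeIndex (canonical i t n w) = ⟨ 2 , ⟨ i , ⟨ t , ⟨ n , w ⟩ ⟩ ⟩ ⟩

decode-encodeIndex : ∀ I → decode (encodeIndex I) ≡ I
decode-encodeIndex (token x m)
  rewrite π₁-⟨,⟩ 0 ⟨ x , m ⟩ | π₂-⟨,⟩ 0 ⟨ x , m ⟩ | π₁-⟨,⟩ x m | π₂-⟨,⟩ x m = refl
decode-encodeIndex (worker j s)
  rewrite π₁-⟨,⟩ 1 ⟨ j , s ⟩ | π₂-⟨,⟩ 1 ⟨ j , s ⟩ | π₁-⟨,⟩ j s | π₂-⟨,⟩ j s = refl
decode-encodeIndex (canonical i t n w)
  rewrite π₁-⟨,⟩ 2 ⟨ i , ⟨ t , ⟨ n , w ⟩ ⟩ ⟩ | π₂-⟨,⟩ 2 ⟨ i , ⟨ t , ⟨ n , w ⟩ ⟩ ⟩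
        | π₁-⟨,⟩ i ⟨ t , ⟨ n , w ⟩ ⟩ | π₂-⟨,⟩ i ⟨ t , ⟨ n , w ⟩ ⟩
        | π₁-⟨,⟩ t ⟨ n , w ⟩ | π₂-⟨,⟩ t ⟨ n , w ⟩ | π₁-⟨,⟩ n w | π₂-⟨,⟩ n w = refl

-- `decode` is not injective, since all tags from 2 on yield canonical indices. On tokens and
-- workers it is, so that equal workers are the same program and are tied by reflexivity.
encodeIndex-decode-token : ∀ p {x m} → decode p ≡ token x m → p ≡ tokenCode x m
encodeIndex-decode-token p eq with π₁ p in tag
encodeIndex-decode-token p refl | 0 = trans (sym (⟨π₁,π₂⟩ p)) (cong₂ ⟨_,_⟩ tag (sym (⟨π₁,π₂⟩ (π₂ p))))
encodeIndex-decode-token p () | suc zero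
encodeIndex-decode-token p () | suc (suc _)

encodeIndex-decode-worker : ∀ p {j s} → decode p ≡ worker j s → p ≡ ⟨ 1 , ⟨ j , s ⟩ ⟩
encodeIndex-decode-worker p eq with π₁ p in tag
encodeIndex-decode-worker p refl | 1 = trans (sym (⟨π₁,π₂⟩ p)) (cong₂ ⟨_,_⟩ tag (sym (⟨π₁,π₂⟩ (π₂ p))))
encodeIndex-decode-worker p () | zero
encodeIndex-decode-worker p () | suc (suc _)

occupied : ℕ → ℕ → ℕ → ℕ → ℕ
occupied b n w x = ∑ b (λ m → neg ∣ position w x m - n ∣)

-- A canonical index shows the stage-t approximation of φ i on {0, …, 2n},
-- filled up with zeros, provided that w proves this function not to be the
-- final function of a token: its last value is 0, or differs from its
-- value at w, or position n of the group in question is vacant at stage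
-- w ≥ n, hence forever.
invalid′ : ℕ → ℕ → ℕ → ℕ → ℕ → ℕ
invalid′ l i t n w = l * (((w ∸ (n + n)) + neg ∣ pred (φ t i w) - l ∣) *
                          ((n ∸ w) + occupied (suc (2 ^ pred l)) n w (pred l)))

invalid : ℕ → ℕ → ℕ → ℕ → ℕ
invalid i t n w = invalid′ (pred (φ t i (n + n))) i t n w

-- The value suc N means that from stage t on the function is known to
-- have domain {0, …, 2N}.
finished : ℕ → Index → ℕ
-- A number beyond 2^x is a spare index, finished from the start with domain {0}.
finished t (token x m)          = ifz (m ∸ 2 ^ x) 0 1
finished t (worker j s)         =
  -- Before stage `s` the length `s` may still be guessed, so no death is declared earlier.
  ifz (s ∸ t) (ifz ∣ guess t j - s ∣ 0 (suc (lastAlive t j s))) 0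
finished t (canonical i t₀ n w) = ifz (invalid i t₀ n w) (suc n) 1

content : ℕ → Index → ℕ → ℕ
content t (token x m)          y = 0
content t (worker j s)         y = pred (χ (lastAlive t j s) j y)
content t (canonical i t₀ n w) y = ifz (invalid i t₀ n w) (pred (φ t₀ i y)) 0

live : ℕ → Index → ℕ → ℕ
live t (token x m)          y = ifz (y ∸ (position t x m + position t x m)) (suc (suc x)) 0
live t (worker j s)         y = ifz ∣ guess t j - s ∣ (χ t j y) 0
live t (canonical i t₀ n w) y = 0

display : (f l c y : ℕ) → ℕ
display f l c y = ifz f l (ifz (y ∸ (pred f + pred f)) (suc c) 0)

value : ℕ → Index → ℕ → ℕ
value t I y = display (finished t I) (live t I y) (content t I y) y

occupied-total : Total 4 occupied
occupied-total = ∑-total {f = λ m n w x → neg ∣ position w x m - n ∣} (explicit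
  (neg-total · (∣-∣-total · (position-total · # 2F ∷ # 3F ∷ # 0F ∷ []) ∷ # 1F ∷ []) ∷ [])
  λ { (_ ∷ _ ∷ _ ∷ _ ∷ []) → refl })

invalid′-total : Total 5 invalid′
invalid′-total = explicit
  (*-total · l ∷
    (*-total ·
      (+-total · (∸-total · w ∷ (+-total · ν ∷ ν ∷ []) ∷ []) ∷
        (neg-total · (∣-∣-total · (pred-total · (φ-total · t ∷ i ∷ w ∷ []) ∷ []) ∷ l ∷ []) ∷ []) ∷ []) ∷
      (+-total · (∸-total · ν ∷ w ∷ []) ∷
        (occupied-total · (suc-total · (2^-total · (pred-total · l ∷ []) ∷ []) ∷ []) ∷ ν ∷ w ∷
          (pred-total · l ∷ []) ∷ []) ∷ []) ∷ []) ∷ [])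
  λ { (_ ∷ _ ∷ _ ∷ _ ∷ _ ∷ []) → refl }
  where
  l i t ν w : Term 5
  l = # 0F
  i = # 1F
  t = # 2F
  ν = # 3F
  w = # 4F

invalid-total : Total 4 invalid
invalid-total = explicit
  (invalid′-total ·
    (pred-total · (φ-total · # 1F ∷ # 0F ∷ (+-total · # 2F ∷ # 2F ∷ []) ∷ []) ∷ []) ∷
    # 0F ∷ # 1F ∷ # 2F ∷ # 3F ∷ [])
  λ { (_ ∷ _ ∷ _ ∷ _ ∷ []) → refl }

display-total : Total 4 display
display-total = explicit
  (ifz-total · # 0F ∷ # 1F ∷
    (ifz-total ·
      (∸-total · # 3F ∷ (+-total · (pred-total · # 0F ∷ []) ∷ (pred-total · # 0F ∷ []) ∷ []) ∷ []) ∷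
      (suc-total · # 2F ∷ []) ∷ lit 0 ∷ []) ∷ [])
  λ { (_ ∷ _ ∷ _ ∷ _ ∷ []) → refl }

invalidTerm : Term n → Term n
invalidTerm a = invalid-total ·
  (π₁-total · a ∷ []) ∷ (π₁-total · (π₂-total · a ∷ []) ∷ []) ∷
  (π₁-total · (π₂-total · (π₂-total · a ∷ []) ∷ []) ∷ []) ∷
  (π₂-total · (π₂-total · (π₂-total · a ∷ []) ∷ []) ∷ []) ∷ []

finishedCode-total : Total 2 (λ t p → finished t (decode p))
finishedCode-total = explicit
  (tagged · (π₁-total · # 1F ∷ []) ∷ # 0F ∷ (π₂-total · # 1F ∷ []) ∷ []) λ { (_ ∷ _ ∷ []) → refl }
  where
  κ t a b c : Term 3
  κ = # 0F
  t = # 1F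
  a = # 2F
  b = π₁-total · a ∷ []
  c = π₂-total · a ∷ []
  tagged : Total 3 (λ κ t a → finished t (decodeTagged κ a))
  tagged = explicit (switch κ
    ( (ifz-total · (∸-total · c ∷ (2^-total · b ∷ []) ∷ []) ∷ lit 0 ∷ lit 1 ∷ [])
    ∷ (ifz-total · (∸-total · c ∷ t ∷ []) ∷
        (ifz-total · (∣-∣-total · (guess-total · t ∷ b ∷ []) ∷ c ∷ []) ∷ lit 0 ∷
          (suc-total · (lastAlive-total · t ∷ b ∷ c ∷ []) ∷ []) ∷ []) ∷ lit 0 ∷ [])
    ∷ (ifz-total · invalidTerm a ∷
        (suc-total · (π₁-total · (π₂-total · c ∷ []) ∷ []) ∷ []) ∷ lit 1 ∷ [])
    ∷ []))
    λ { (0 ∷ _ ∷ _ ∷ []) → refl ; (1 ∷ _ ∷ _ ∷ []) → refl ; (suc (suc _) ∷ _ ∷ _ ∷ []) → refl }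

contentCode-total : Total 3 (λ t p y → content t (decode p) y)
contentCode-total = explicit
  (tagged · (π₁-total · # 1F ∷ []) ∷ # 0F ∷ (π₂-total · # 1F ∷ []) ∷ # 2F ∷ [])
  λ { (_ ∷ _ ∷ _ ∷ []) → refl }
  where
  κ t a b c y : Term 4
  κ = # 0F
  t = # 1F
  a = # 2F
  b = π₁-total · a ∷ []
  c = π₂-total · a ∷ []
  y = # 3F
  tagged : Total 4 (λ κ t a y → content t (decodeTagged κ a) y)
  tagged = explicit (switch κ
    ( lit 0
    ∷ (pred-total · (χ-total · (lastAlive-total · t ∷ b ∷ c ∷ []) ∷ b ∷ y ∷ []) ∷ [])
    ∷ (ifz-total · invalidTerm a ∷
        (pred-total · (φ-total · (π₁-total · c ∷ []) ∷ b ∷ y ∷ []) ∷ []) ∷ lit 0 ∷ [])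
    ∷ []))
    λ { (0 ∷ _ ∷ _ ∷ _ ∷ []) → refl ; (1 ∷ _ ∷ _ ∷ _ ∷ []) → refl
      ; (suc (suc _) ∷ _ ∷ _ ∷ _ ∷ []) → refl }

liveCode-total : Total 3 (λ t p y → live t (decode p) y)
liveCode-total = explicit
  (tagged · (π₁-total · # 1F ∷ []) ∷ # 0F ∷ (π₂-total · # 1F ∷ []) ∷ # 2F ∷ [])
  λ { (_ ∷ _ ∷ _ ∷ []) → refl }
  where
  κ t a b c y pos : Term 4
  κ = # 0F
  t = # 1F
  a = # 2F
  b = π₁-total · a ∷ []
  c = π₂-total · a ∷ []
  y = # 3F
  pos = position-total · t ∷ b ∷ c ∷ []
  tagged : Total 4 (λ κ t a y → live t (decodeTagged κ a) y)
  tagged = explicit (switch κ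
    ( (ifz-total · (∸-total · y ∷ (+-total · pos ∷ pos ∷ []) ∷ []) ∷
        (suc-total · (suc-total · b ∷ []) ∷ []) ∷ lit 0 ∷ [])
    ∷ (ifz-total · (∣-∣-total · (guess-total · t ∷ b ∷ []) ∷ c ∷ []) ∷
        (χ-total · t ∷ b ∷ y ∷ []) ∷ lit 0 ∷ [])
    ∷ lit 0
    ∷ []))
    λ { (0 ∷ _ ∷ _ ∷ _ ∷ []) → refl ; (1 ∷ _ ∷ _ ∷ _ ∷ []) → refl
      ; (suc (suc _) ∷ _ ∷ _ ∷ _ ∷ []) → refl }

valueCode-total : Total 3 (λ t p y → value t (decode p) y)
valueCode-total = explicit
  (display-total · (finishedCode-total · # 0F ∷ # 1F ∷ []) ∷
    (liveCode-total · # 0F ∷ # 1F ∷ # 2F ∷ []) ∷ (contentCode-total · # 0F ∷ # 1F ∷ # 2F ∷ []) ∷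
    # 2F ∷ [])
  λ { (_ ∷ _ ∷ _ ∷ []) → refl }

value-live : ∀ {t I y} → finished t I ≡ 0 → value t I y ≡ live t I y
value-live eq = ifz-yes eq

value-finished : ∀ {t I y N} → finished t I ≡ suc N →
                 value t I y ≡ ifz (y ∸ (N + N)) (suc (content t I y)) 0
value-finished {t} {I} eq with finished t I
value-finished refl | suc N = refl

finished-step : ∀ I t N → finished t I ≡ suc N →
                finished (suc t) I ≡ suc N × (∀ y → content (suc t) I y ≡ content t I y)
finished-step (token x m) t N eq = eq , λ y → refl
finished-step (canonical i t₀ n w) t N eq = eq , λ y → refl
finished-step (worker j s) t N eq
  with s ∸ t in s≤t | ∣ guess t j - s ∣ in dead
... | zero | suc _ =
  trans (ifz-yes (m≤n⇒m∸n≡0 (m≤n⇒m≤1+n (m∸n≡0⇒m≤n {s} s≤t))))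
    (trans (ifz-no (≢⇒∣-∣≢0 still-dead)) (trans (cong suc same) eq)) ,
  λ y → cong (λ a → pred (χ a j y)) same
  where
  still-dead : guess (suc t) j ≢ s
  still-dead = guess-stays-away t j s (m∸n≡0⇒m≤n s≤t) (∣-∣≢0⇒≢ (≡suc⇒≢0 dead))
  same : lastAlive (suc t) j s ≡ lastAlive t j s
  same = lastAlive-dead t j s still-dead

finished-value-step : ∀ I t N → finished t I ≡ suc N → ∀ y → value (suc t) I y ≡ value t I y
finished-value-step I t N eq y with eq′ , same ← finished-step I t N eq =
  trans (value-finished {suc t} {I} eq′)
    (trans (cong (λ c → ifz (y ∸ (N + N)) (suc c) 0) (same y)) (sym (value-finished {t} {I} eq)))

finished-forever : ∀ I {t u N} → t ≤ u → finished t I ≡ suc N →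
                   finished u I ≡ suc N × (∀ y → value u I y ≡ value t I y)
finished-forever I t≤u eq = go (≤⇒≤′ t≤u)
  where
  go : ∀ {u} → _ ≤′ u → finished u I ≡ _ × (∀ y → value u I y ≡ value _ I y)
  go ≤′-refl = eq , λ y → refl
  go (≤′-step t≤′u) with eq′ , same ← go t≤′u =
    proj₁ (finished-step I _ _ eq′) ,
    λ y → trans (finished-value-step I _ _ eq′ y) (same y)

token-live : ∀ {t x m} → m ≤ 2 ^ x → finished t (token x m) ≡ 0
token-live {t} {x} {m} m≤ = ifz-yes (m≤n⇒m∸n≡0 m≤)

token-invalid : ∀ {t x m} → ¬ m ≤ 2 ^ x → finished t (token x m) ≡ 1
token-invalid m≰ = ifz-no (m>n⇒m∸n≢0 (≰⇒> m≰))

worker-alive : ∀ {t j s} → guess t j ≡ s → finished t (worker j s) ≡ 0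
worker-alive {t} {j} {s} eq with s ∸ t
... | zero  = ifz-yes (m≡n⇒∣m-n∣≡0 eq)
... | suc _ = refl

worker-dead : ∀ {t j s} → s ≤ t → guess t j ≢ s →
              finished t (worker j s) ≡ suc (lastAlive t j s)
worker-dead s≤t ≢s = trans (ifz-yes (m≤n⇒m∸n≡0 s≤t)) (ifz-no (≢⇒∣-∣≢0 ≢s))

value-worker-alive : ∀ {t j s y} → guess t j ≡ s → value t (worker j s) y ≡ χ t j y
value-worker-alive {t} {j} {s} {y} eq =
  trans (value-live {t} {worker j s} {y} (worker-alive {t} eq)) (ifz-yes (m≡n⇒∣m-n∣≡0 eq))

ifz-≡suc : ∀ {c a v} → ifz c a 0 ≡ suc v → c ≡ 0 × a ≡ suc v
ifz-≡suc {zero} eq = refl , eq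

value-persistent : ∀ I → Persistent₂ (λ t → value t I)
value-persistent I y t v eq with finished t I in fin
... | suc N = trans (finished-value-step I t N fin y)
  (trans (value-finished {t} {I} fin) eq)
value-persistent (token x m) y t v eq | zero = live-persists
  where
  m≤ : m ≤ 2 ^ x
  m≤ with m ≤? 2 ^ x
  ... | yes m≤ = m≤
  ... | no  m≰ = contradiction (trans (sym (token-invalid {t} {x} {m} m≰)) fin) λ ()
  live-persists : value (suc t) (token x m) y ≡ suc v
  live-persists with y≤ , eq′ ← ifz-≡suc {y ∸ (position t x m + position t x m)} eq =
    trans (value-live {suc t} {token x m} {y} (token-live {suc t} {x} {m} m≤))
      (trans (ifz-yes (m≤n⇒m∸n≡0 (≤-trans (m∸n≡0⇒m≤n {y} y≤)
        (+-mono-≤ (position-mono t x m m≤) (position-mono t x m m≤))))) eq′)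
value-persistent (worker j s) y t v eq | zero
  with alive , eq′ ← ifz-≡suc {∣ guess t j - s ∣} eq
  with guess (suc t) j ≟ s
... | yes still = trans (value-worker-alive {suc t} still) (χ-persistent j y t v eq′)
-- At its death the worker switches from `live` to `content`, frozen at stage `t`. Everything shown
-- so far has an argument below `t`, hence within {0, ..., 2t}, and keeps its value.
... | no  dead  =
  trans (value-finished {suc t} {worker j s} (worker-dead {suc t} s≤1+t dead))
    (trans (ifz-yes (m≤n⇒m∸n≡0 y≤))
      (cong suc (trans (cong (λ a → pred (χ a j y)) last) (cong pred eq′))))
  where
  guess≡ : guess t j ≡ s
  guess≡ = ∣m-n∣≡0⇒m≡n alive
  s≤1+t : s ≤ suc t
  s≤1+t = m≤n⇒m≤1+n (subst (_≤ t) guess≡ (guess≤ t j))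
  last : lastAlive (suc t) j s ≡ t
  last = trans (lastAlive-dead t j s dead) (lastAlive-alive t j s guess≡)
  y≤ : y ≤ lastAlive (suc t) j s + lastAlive (suc t) j s
  y≤ = subst (λ a → y ≤ a + a) (sym last) (≤-trans (<⇒≤ (χ-defined⇒< eq′)) (n≤n+n t))

finished-OddSegment : ∀ I {t N} → finished t I ≡ suc N → OddSegment (λ t → value t I) N
finished-OddSegment I {t} {N} fin y = mk⇔ to from
  where
  to : Defined (λ t → value t I) y → y ≤ N + N
  to (v , u , eq) with y ≤? N + N
  ... | yes y≤ = y≤
  ... | no  y≰ = contradiction
    (trans (sym (persists (value-persistent I y) (m≤m⊔n u t) eq))
      (trans (proj₂ (finished-forever I (m≤n⊔m u t) fin) y)
        (trans (value-finished {t} {I} fin) (ifz-no (m>n⇒m∸n≢0 (≰⇒> y≰)))))) λ ()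
  from : y ≤ N + N → Defined (λ t → value t I) y
  from y≤ = content t I y , t ,
    trans (value-finished {t} {I} fin) (ifz-yes (m≤n⇒m∸n≡0 y≤))

-- Settled stages and the final functions of tokens

Settled : (ℕ → ℕ) → ℕ → Set
Settled h T = ∀ t → T ≤ t → h t ≡ h T

Settled-later : ∀ {h T U} → T ≤ U → Settled h T → Settled h U
Settled-later T≤U settled t U≤t = trans (settled t (≤-trans T≤U U≤t)) (sym (settled _ T≤U))

settled-↓ : ∀ {h T v} → Persistent h → Settled h T → h ↓ v → ∀ t → T ≤ t → h t ≡ suc v
settled-↓ {h} {T} persistent settled (u , eq) t T≤t = begin
  h t        ≡⟨ settled t T≤t ⟩
  h T        ≡⟨ settled (T ⊔ u) (m≤m⊔n T u) ⟨
  h (T ⊔ u)  ≡⟨ persists persistent (m≤n⊔m T u) eq ⟩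
  suc _      ∎
  where open ≡-Reasoning

bounded-choice : ∀ n (P : ℕ → ℕ → Set) → (∀ {k b c} → b ≤ c → P k b → P k c) →
                 (∀ k → k < n → ∃[ b ] P k b) → ∃[ b ] (∀ k → k < n → P k b)
bounded-choice zero    P weaken choose = 0 , λ _ ()
bounded-choice (suc n) P weaken choose
  with b , below ← bounded-choice n P weaken (λ k k<n → choose k (m<n⇒m<1+n k<n))
  with c , last ← choose n (n<1+n n) =
  b ⊔ c , λ k k<1+n → case m<1+n⇒m<n∨m≡n k<1+n of λ
    { (inj₁ k<n) → weaken (m≤m⊔n b c) (below k k<n)
    ; (inj₂ refl) → weaken (m≤n⊔m b c) last }

Least : ℕ → Set
Least j = ∀ k → k < j → ¬ ((λ t → χ t k) ≃ (λ t → χ t j))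

Group : ℕ → ℕ → Set
Group x T = ∀ m → m ≤ 2 ^ x → Settled (λ t → position t x m) T

tokenFunction : ∀ x m {T n} → m ≤ 2 ^ x → Settled (λ t → position t x m) T → position T x m ≡ n →
                ∀ y v → (λ t → value t (token x m) y) ↓ v ⇔ (y ≤ n + n × v ≡ suc x)
tokenFunction x m {T} m≤ settled refl y v = mk⇔ to from
  where
  N : ℕ
  N = position T x m
  value≡ : ∀ t → T ≤ t → value t (token x m) y ≡ ifz (y ∸ (N + N)) (suc (suc x)) 0
  value≡ t T≤t = trans (value-live {t} {token x m} {y} (token-live {t} {x} {m} m≤))
    (cong (λ N → ifz (y ∸ (N + N)) (suc (suc x)) 0) (settled t T≤t))
  to : (λ t → value t (token x m) y) ↓ v → y ≤ N + N × v ≡ suc x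
  to (t , eq) with y≤ , eq′ ← ifz-≡suc {y ∸ (N + N)}
      (trans (sym (value≡ (t ⊔ T) (m≤n⊔m t T)))
             (persists (value-persistent (token x m) y) (m≤m⊔n t T) eq)) =
    m∸n≡0⇒m≤n y≤ , sym (suc-injective eq′)
  from : y ≤ N + N × v ≡ suc x → (λ t → value t (token x m) y) ↓ v
  from (y≤ , refl) = T , trans (value≡ T ≤-refl) (ifz-yes (m≤n⇒m∸n≡0 y≤))

tokenFunction-OddSegment : ∀ x m {T n} → m ≤ 2 ^ x → Settled (λ t → position t x m) T →
                           position T x m ≡ n → OddSegment (λ t → value t (token x m)) n
tokenFunction-OddSegment x m m≤ settled eq y = mk⇔
  (λ { (v , defined) → proj₁ (Equivalence.to (tokenFunction x m m≤ settled eq y v) defined) })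
  (λ y≤ → _ , Equivalence.from (tokenFunction x m m≤ settled eq y _) (y≤ , refl))

-- Classical limits

module Construction (em : ExcludedMiddle 0ℓ) where

  settles : ∀ {h} → Persistent h → ∃[ T ] Settled h T
  settles {h} persistent with em {∃[ v ] h ↓ v}
  ... | yes (v , T , eq) = T , λ t T≤t → trans (persists persistent T≤t eq) (sym eq)
  ... | no  never = 0 , λ t _ → trans (undefined t) (sym (undefined 0))
    where
    undefined : ∀ t → h t ≡ 0
    undefined t with h t in eq
    ... | zero  = refl
    ... | suc v = contradiction (v , t , eq) never

  -- Every failure to settle raises `h` by at least one; `d` bounds the rises that are left.
  bounded-settles : ∀ {h} B → (∀ t → h t ≤ h (suc t)) → (∀ t → h t ≤ B) → ∃[ T ] Settled h T
  bounded-settles {h} B mono bounded = go B 0 (m≤n+m B (h 0))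
    where
    mono* : ∀ {t u} → t ≤ u → h t ≤ h u
    mono* t≤u = go′ (≤⇒≤′ t≤u)
      where
      go′ : ∀ {t u} → t ≤′ u → h t ≤ h u
      go′ ≤′-refl      = ≤-refl
      go′ (≤′-step t≤) = ≤-trans (go′ t≤) (mono _)
    go : ∀ d T → B ≤ h T + d → ∃[ T ] Settled h T
    go d T B≤ with em {∃[ t ] T ≤ t × h t ≢ h T}
    ... | no  none = T , λ t T≤t → case h t ≟ h T of λ
      { (yes eq) → eq ; (no ≢) → contradiction (t , T≤t , ≢) none }
    go zero T B≤ | yes (t , T≤t , ≢) = contradiction
      (≤-antisym (≤-trans (bounded t) (subst (B ≤_) (+-identityʳ (h T)) B≤)) (mono* T≤t)) ≢
    go (suc d) T B≤ | yes (t , T≤t , ≢) = go d t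
      (≤-trans (subst (B ≤_) (+-suc (h T) d) B≤)
               (+-monoˡ-≤ d (≤∧≢⇒< (mono* T≤t) (≢ ∘ sym))))

  ≃⇒eventually-≡ : ∀ {f g} → Persistent₂ f → Persistent₂ g → f ≃ g →
                   ∀ y → ∃[ T ] (∀ t → T ≤ t → f t y ≡ g t y)
  ≃⇒eventually-≡ {f} {g} f-persistent g-persistent f≃g y
    with T , f-settled ← settles (f-persistent y)
    with U , g-settled ← settles (g-persistent y) =
    T ⊔ U , λ t ≤t → agree t (m⊔n≤o⇒m≤o T U ≤t) (m⊔n≤o⇒n≤o T U ≤t)
    where
    agree : ∀ t → T ≤ t → U ≤ t → f t y ≡ g t y
    agree t T≤t U≤t with f t y in f≡ | g t y in g≡
    ... | zero  | zero  = refl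
    ... | suc v | _     = trans (sym (settled-↓ (g-persistent y) g-settled
      (Equivalence.to (f≃g y v) (t , f≡)) t U≤t)) g≡
    ... | zero  | suc v = trans (sym f≡) (settled-↓ (f-persistent y) f-settled
      (Equivalence.from (f≃g y v) (t , g≡)) t T≤t)

  -- Approximations may differ for a while even if the functions agree; only a lasting difference at
  -- one argument separates them.
  Differ : (f g : ℕ → ℕ → ℕ) → Set
  Differ f g = ∃[ y ] ∃[ T ] (∀ t → T ≤ t → f t y ≢ g t y)

  ¬Differ⇒≃ : ∀ {f g} → Persistent₂ f → Persistent₂ g → ¬ Differ f g → f ≃ g
  ¬Differ⇒≃ {f} {g} f-persistent g-persistent same y v = mk⇔
    (transfer f-persistent g-persistent same)
    (transfer g-persistent f-persistent
      (λ { (y , T , differ) → same (y , T , λ t T≤t eq → differ t T≤t (sym eq)) }))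
    where
    transfer : ∀ {f g} → Persistent₂ f → Persistent₂ g → ¬ Differ f g →
               (λ t → f t y) ↓ v → (λ t → g t y) ↓ v
    transfer {f} {g} f-persistent g-persistent same fy↓v
      with T , f-settled ← settles (f-persistent y)
      with U , g-settled ← settles (g-persistent y)
      with g U y ≟ suc v
    ... | yes eq = U , eq
    ... | no  ≢  = contradiction
      (y , T ⊔ U , λ t ≤t eq → ≢ (trans (sym (g-settled t (m⊔n≤o⇒n≤o T U ≤t)))
        (trans (sym eq) (settled-↓ (f-persistent y) f-settled fy↓v t (m⊔n≤o⇒m≤o T U ≤t)))))
      same

  -- Least indices and convergence of guesses

  least-index : ∀ j → ∃[ k ] Least k × (λ t → χ t k) ≃ (λ t → χ t j)
  least-index j = go (suc j) j (n<1+n j)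
    where
    go : ∀ b j → j < b → ∃[ k ] Least k × (λ t → χ t k) ≃ (λ t → χ t j)
    go (suc b) j (s≤s j≤b) with em {∃[ k ] k < j × (λ t → χ t k) ≃ (λ t → χ t j)}
    ... | no  none = j , (λ k k<j same → none (k , k<j , same)) , ≃-refl {λ t → χ t j}
    ... | yes (k , k<j , same) with l , least , same′ ← go b k (<-≤-trans k<j j≤b) =
      l , least , ≃-trans {λ t → χ t l} {λ t → χ t k} {λ t → χ t j} same′ same

  Separated : ℕ → ℕ → ℕ → Set
  Separated j k b = ∀ t w → b ≤ t → b ≤ w → distance w t k j ≢ 0

  separates : ∀ j k → ¬ ((λ t → χ t k) ≃ (λ t → χ t j)) → ∃[ b ] Separated j k b
  separates j k ≄ with em {Differ (λ t → χ t k) (λ t → χ t j)}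
  ... | no  same = contradiction (¬Differ⇒≃ (χ-persistent k) (χ-persistent j) same) ≄
  ... | yes (y , T , differ) = suc y ⊔ T , λ t w ≤t ≤w →
    nonzero-∑ w y (m⊔n≤o⇒m≤o (suc y) T ≤w) (≢⇒∣-∣≢0 (differ t (m⊔n≤o⇒n≤o (suc y) T ≤t)))

  -- From some stage and length `b` on, all earlier indices visibly differ from `j`. A guess made
  -- after `b` is never revised, and if none is made, the guess at `b` is final.
  guess-converges : ∀ j → Least j → ∃[ s ] ∃[ T ] (∀ t → T ≤ t → guess t j ≡ s)
  guess-converges j least
    with b , separated ← bounded-choice j (Separated j)
      (λ b≤c sep t w c≤t c≤w → sep t w (≤-trans b≤c c≤t) (≤-trans b≤c c≤w))
      (λ k k<j → separates j k (least k k<j))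
    with em {∃[ t ] b ≤ t × guess (suc t) j ≡ suc t}
  ... | yes (t , b≤t , new) = suc t , suc t , λ u t<u → constant (≤⇒≤′ t<u)
    where
    constant : ∀ {u} → suc t ≤′ u → guess u j ≡ suc t
    constant ≤′-refl = new
    constant (≤′-step {u} t<u) = trans (ifz-yes (zero-∑ j λ k k<j →
      ≢0⇒neg≡0 (separated k k<j u (guess u j) b≤u
        (subst (b ≤_) (sym (constant t<u)) (m≤n⇒m≤1+n b≤t))))) (constant t<u)
      where
      b≤u : b ≤ u
      b≤u = ≤-trans b≤t (<⇒≤ (≤′⇒≤ t<u))
  ... | no  never = guess b j , b , λ u b≤u → constant (≤⇒≤′ b≤u)
    where
    constant : ∀ {u} → b ≤′ u → guess u j ≡ guess b j
    constant ≤′-refl = refl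
    constant (≤′-step {u} b≤u) with guess-step u j
    ... | inj₁ same = trans same (constant b≤u)
    ... | inj₂ new  = contradiction (u , ≤′⇒≤ b≤u , new) never

  -- An earlier index of the same function would agree with `j` below the fixed length `s` at some
  -- late stage, forcing a new guess.
  survivor-least : ∀ j s → (∀ t → s ≤ t → guess t j ≡ s) → Least j
  survivor-least j s survives k k<j same
    with T , agree ← bounded-choice s (λ y T → ∀ t → T ≤ t → χ t k y ≡ χ t j y)
      (λ b≤c eq t c≤t → eq t (≤-trans b≤c c≤t))
      (λ y _ → ≃⇒eventually-≡ (χ-persistent k) (χ-persistent j) same y) =
    1+n≰n (≤-trans (≤-reflexive (trans (sym reset) (survives (suc t) (m≤n⇒m≤1+n s≤t)))) s≤t)
    where
    t : ℕ
    t = T ⊔ s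
    s≤t : s ≤ t
    s≤t = m≤n⊔m T s
    reset : guess (suc t) j ≡ suc t
    reset = ifz-no (nonzero-∑ j k k<j (subst (λ d → neg d ≢ 0)
      (sym (trans (cong (λ w → distance w t k j) (survives t s≤t))
        (zero-∑ s λ y y<s → m≡n⇒∣m-n∣≡0 (agree y y<s t (m≤m⊔n T s))))) λ ()))

  -- Coverage by `χ`

  module _ (i : ℕ) where

    private
      D : ℕ → Set
      D = Defined (λ t → φ t i)

    -- A gap in the domain is caught by a gapped index. Without gaps the domain is downward closed;
    -- unless it is some {0, ..., 2n}, each 2n in it is accompanied by 2n+1, so showing complete
    -- pairs loses nothing.
    φ-cover : (∃[ j ] (λ t → χ t j) ≃ (λ t → φ t i)) ⊎ (∃[ n ] OddSegment (λ t → φ t i) n)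
    φ-cover with em {∃[ g ] ∃[ z ] g < z × ¬ D g × D z}
    ... | yes (g , z , g<z , ¬g , (z-value , u , z↓)) = inj₁ (⟨ i , ⟨ g , z ⟩ ⟩ , same)
      where
      χ≡ : ∀ t y → χ t ⟨ i , ⟨ g , z ⟩ ⟩ y ≡ gapped t i g z y
      χ≡ t y = trans (χ-⟨,⟩ t i g z y) (ifz-yes (m≤n⇒m∸n≡0 g<z))
      same : (λ t → χ t ⟨ i , ⟨ g , z ⟩ ⟩) ≃ (λ t → φ t i)
      same y v = mk⇔
        (λ { (t , eq) → t , χ-persistent-φ t eq })
        (λ { (t , eq) → t ⊔ u , trans (χ≡ (t ⊔ u) y) (≡-gapped {t ⊔ u} {i} {g} {z} {y}
          (λ { refl → ¬g (v , t , eq) })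
          (≡suc⇒≢0 (persists (φ-persistent i z) (m≤n⊔m t u) z↓))
          (persists (φ-persistent i y) (m≤m⊔n t u) eq)) })
        where
        χ-persistent-φ : ∀ t → χ t ⟨ i , ⟨ g , z ⟩ ⟩ y ≡ suc v → φ t i y ≡ suc v
        χ-persistent-φ t eq = proj₂ (proj₂ (gapped-≡ {t} {i} {g} {z} {y} (trans (sym (χ≡ t y)) eq)))
    ... | no  no-gap with em {∃[ n ] D (n + n) × ¬ D (suc (n + n))}
    ...   | yes (n , last , ¬next) = inj₂ (n , λ y → mk⇔ to from)
      where
      to : ∀ {y} → D y → y ≤ n + n
      to {y} y↓ with y ≤? n + n
      ... | yes y≤ = y≤
      ... | no  y≰ with m≤n⇒m<n∨m≡n (≰⇒> y≰)
      ...   | inj₁ next<y = contradiction (suc (n + n) , y , next<y , ¬next , y↓) no-gap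
      ...   | inj₂ refl   = contradiction y↓ ¬next
      from : ∀ {y} → y ≤ n + n → D y
      from {y} y≤ with em {D y} | m≤n⇒m<n∨m≡n y≤
      ... | yes y↓ | _         = y↓
      ... | no  _  | inj₂ refl = last
      ... | no  ¬y | inj₁ y<   = contradiction (y , n + n , y< , ¬y , last) no-gap
    -- Since 0 < 0 fails, the parameters ⟨ 0 , 0 ⟩ select the paired approximation.
    ...   | no  no-last = inj₁ (⟨ i , ⟨ 0 , 0 ⟩ ⟩ , same)
      where
      top : ∀ {y} → D y → D (pairTop y)
      top {y} y↓ with halve y
      ... | n , inj₂ refl = subst D (sym (pairTop-odd n)) y↓
      ... | n , inj₁ refl with em {D (suc (n + n))}
      ...   | yes next = subst D (sym (pairTop-even n)) next
      ...   | no ¬next = contradiction (n , y↓ , ¬next) no-last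
      below : ∀ {x y} → x ≤ y → D y → D x
      below {x} {y} x≤y y↓ with em {D x} | m≤n⇒m<n∨m≡n x≤y
      ... | yes x↓ | _         = x↓
      ... | no  _  | inj₂ refl = y↓
      ... | no  ¬x | inj₁ x<y  = contradiction (x , y , x<y , ¬x , y↓) no-gap
      same : (λ t → χ t ⟨ i , ⟨ 0 , 0 ⟩ ⟩) ≃ (λ t → φ t i)
      same y v = mk⇔
        (λ { (t , eq) → t , proj₂ (paired-≡ {t} {i} {y} (trans (sym (χ-⟨,⟩ t i 0 0 y)) eq)) })
        show
        where
        show : (λ t → φ t i y) ↓ v → (λ t → χ t ⟨ i , ⟨ 0 , 0 ⟩ ⟩ y) ↓ v
        show (t , eq)
          with u , all↓ ← bounded-choice (suc (pairTop y)) (λ x u → φ u i x ≢ 0)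
            (λ {x} b≤c ≢0 → ≡suc⇒≢0 (persists (φ-persistent i x) b≤c (≢0⇒≡suc ≢0)))
            (λ x x≤ → case below (≤-pred x≤) (top (v , t , eq)) of λ
              { (w , u , eq) → u , ≡suc⇒≢0 eq }) =
          t ⊔ u , trans (χ-⟨,⟩ (t ⊔ u) i 0 0 y) (≡-paired {t ⊔ u} {i} {y}
            (λ x x≤ → ≡suc⇒≢0 (persists (φ-persistent i x) (m≤n⊔m t u) (≢0⇒≡suc (all↓ x (s≤s x≤)))))
            (persists (φ-persistent i y) (m≤m⊔n t u) eq))

  -- States only grow and stay below 2^x. Once all of them are constant, there is no further change,
  -- so the block is fixed too.
  group-settles : ∀ x → ∃[ T ] Group x T
  group-settles x
    with T , settled ← bounded-choice (suc (2 ^ x)) (λ m T → Settled (λ t → tokenState t x m) T)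
      Settled-later
      (λ m _ → bounded-settles (2 ^ x) (λ t → state-mono x t (tokenCode x m))
        (λ t → <⇒≤ (state< x t (tokenCode x m)))) =
    T , λ m m≤ t T≤t → constant m m≤ (≤⇒≤′ T≤t)
    where
    no-change : ∀ t → T ≤ t → change t x ≡ 0
    no-change t T≤t = zero-∑ (suc (2 ^ x)) λ m m< → m≡n⇒∣m-n∣≡0
      (trans (settled m m< (suc t) (m≤n⇒m≤1+n T≤t)) (sym (settled m m< t T≤t)))
    constant : ∀ m → m ≤ 2 ^ x → ∀ {t} → T ≤′ t → position t x m ≡ position T x m
    constant m m≤ ≤′-refl = refl
    constant m m≤ (≤′-step {t} T≤t) = trans
      (cong₂ (λ l s → l * 2 ^ x + s) (ifz-yes (no-change t (≤′⇒≤ T≤t)))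
        (trans (settled m (s≤s m≤) (suc t) (m≤n⇒m≤1+n (≤′⇒≤ T≤t)))
               (sym (settled m (s≤s m≤) t (≤′⇒≤ T≤t)))))
      (constant m m≤ T≤t)

  -- Which indices have equal functions

  V : Index → ℕ → ℕ → ℕ
  V I t y = value t I y

  data Class : Index → Set where
    isToken    : ∀ {x m} → m ≤ 2 ^ x → Class (token x m)
    isWorker   : ∀ {j s} → (∀ t → s ≤ t → guess t j ≡ s) → Class (worker j s)
    isFinished : ∀ {I t N} → finished t I ≡ suc N → Class I

  classify : ∀ I → Class I
  classify (token x m) with m ≤? 2 ^ x
  ... | yes m≤ = isToken m≤
  ... | no  m≰ = isFinished {t = 0} (token-invalid {0} {x} {m} m≰)
  classify (worker j s) with em {∃[ t ] s ≤ t × guess t j ≢ s}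
  ... | yes (t , s≤t , dead) = isFinished {t = t} (worker-dead {t} {j} {s} s≤t dead)
  ... | no  none = isWorker λ t s≤t → case guess t j ≟ s of λ
    { (yes alive) → alive ; (no dead) → contradiction (t , s≤t , dead) none }
  classify (canonical i t n w) with invalid i t n w in eq
  ... | zero  = isFinished {t = 0} (ifz-yes eq)
  ... | suc _ = isFinished {t = 0} (ifz-no (≡suc⇒≢0 eq))

  worker-≃ : ∀ {j s} T → (∀ t → T ≤ t → guess t j ≡ s) → V (worker j s) ≃ (λ t → χ t j)
  worker-≃ {j} {s} T alive = eventually-≃ (value-persistent (worker j s)) (χ-persistent j) T
    λ t T≤t y → value-worker-alive {t} {j} {s} {y} (alive t T≤t)

  token-OddSegment : ∀ x m → m ≤ 2 ^ x → ∃[ n ] OddSegment (V (token x m)) n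
  token-OddSegment x m m≤ with T , settled ← group-settles x =
    position T x m , tokenFunction-OddSegment x m m≤ (settled m m≤) refl

  worker-not-OddSegment : ∀ j s → (∀ t → s ≤ t → guess t j ≡ s) → ∀ n → ¬ OddSegment (V (worker j s)) n
  worker-not-OddSegment j s alive n segment =
    χ-not-OddSegment j n (OddSegment-resp-≃ {n = n} (worker-≃ {j} {s} s alive) segment)

  -- Otherwise `R` would have to enumerate equalities with a token that may still move. A final
  -- token function is constantly x + 1, and each kind of finished index violates this or sits at a
  -- position that the group never takes.
  finished-not-token : ∀ I x m {t N} → finished t I ≡ suc N → m ≤ 2 ^ x →
                       ¬ (V I ≃ V (token x m))
  finished-not-token I x m {t} {N} fin m≤ same
    with T , settled ← group-settles x = impossible I fin content≡ N≡
    where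
    n* : ℕ
    n* = position T x m
    N≡ : n* ≡ N
    N≡ = OddSegment-unique (tokenFunction-OddSegment x m m≤ (settled m m≤) refl)
      (OddSegment-resp-≃ {n = N} same (finished-OddSegment I {t} fin))
    content≡ : ∀ y → y ≤ N + N → content t I y ≡ suc x
    content≡ y y≤ = proj₂ (Equivalence.to (tokenFunction x m m≤ (settled m m≤) refl y _)
      (Equivalence.to (same y (content t I y))
        (t , trans (value-finished {t} {I} fin) (ifz-yes (m≤n⇒m∸n≡0 y≤)))))
    impossible : ∀ I → finished t I ≡ suc N → (∀ y → y ≤ N + N → content t I y ≡ suc x) →
                 n* ≡ N → ⊥
    impossible (token x′ m′) fin content≡ N≡ with () ← content≡ 0 z≤n
    impossible (worker j s) fin content≡ N≡ with s ∸ t | ∣ guess t j - s ∣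
    ... | zero | suc _ with refl ← fin =
      contradiction (trans (sym (cong pred (χ-bounded N j (N + N) (n≤n+n N))))
        (content≡ (N + N) ≤-refl)) λ ()
    impossible (canonical i t₀ n w) fin content≡ N≡ with invalid i t₀ n w in valid
    ... | suc _ with () ← content≡ 0 z≤n
    ... | zero with refl ← fin
      with m*n≡0⇒m≡0∨n≡0 (pred (φ t₀ i (n + n))) valid
    ... | inj₁ last≡0 with () ← trans (sym (content≡ (n + n) ≤-refl)) last≡0
    ... | inj₂ rest
      with m*n≡0⇒m≡0∨n≡0 ((w ∸ (n + n)) + neg ∣ pred (φ t₀ i w) - pred (φ t₀ i (n + n)) ∣) rest
    ... | inj₁ differs =
      neg≡0⇒≢0 (m+n≡0⇒n≡0 (w ∸ (n + n)) differs)
        (m≡n⇒∣m-n∣≡0 (trans (content≡ w (m∸n≡0⇒m≤n (m+n≡0⇒m≡0 (w ∸ (n + n)) differs)))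
                             (sym (content≡ (n + n) ≤-refl))))
    -- By stage `w ⊔ T` the token has reached its final position, which would be `n` although `n` is
    -- still vacant.
    ... | inj₂ free = vacant-forever x n (m∸n≡0⇒m≤n (m+n≡0⇒m≡0 (n ∸ w) free)) (m≤m⊔n w T) vacant
        m m≤ (trans (settled m m≤ (w ⊔ T) (m≤n⊔m w T)) N≡)
      where
      free′ : occupied (suc (2 ^ x)) n w x ≡ 0
      free′ = subst (λ l → occupied (suc (2 ^ pred l)) n w (pred l) ≡ 0)
        (content≡ (n + n) ≤-refl) (m+n≡0⇒n≡0 (n ∸ w) free)
      vacant : Vacant w x n
      vacant m m≤ eq = neg≡0⇒≢0 (∑-zero (suc (2 ^ x)) free′ m (s≤s m≤)) (m≡n⇒∣m-n∣≡0 eq)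

  data Related : Index → Index → Set where
    sameWorker   : ∀ {j s} → Related (worker j s) (worker j s)
    bothFinished : ∀ {I J t u M N} → finished t I ≡ suc M → finished u J ≡ suc N → Related I J
    sameGroup    : ∀ {x m m′} → m ≤ 2 ^ x → m′ ≤ 2 ^ x → Related (token x m) (token x m′)

  -- Both survivors belong to the least index of the common function, and the late guesses of one
  -- index coincide.
  worker-unique : ∀ {j s j′ s′} → (∀ t → s ≤ t → guess t j ≡ s) → (∀ t → s′ ≤ t → guess t j′ ≡ s′) →
                  V (worker j s) ≃ V (worker j′ s′) → j ≡ j′ × s ≡ s′
  worker-unique {j} {s} {j′} {s′} alive alive′ same with j≡j′
    where
    χ-same : (λ t → χ t j) ≃ (λ t → χ t j′)
    χ-same = ≃-trans {λ t → χ t j} {V (worker j s)} {λ t → χ t j′}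
      (≃-sym {V (worker j s)} {λ t → χ t j} (worker-≃ s alive))
      (≃-trans {V (worker j s)} {V (worker j′ s′)} {λ t → χ t j′} same (worker-≃ s′ alive′))
    j≡j′ : j ≡ j′
    j≡j′ with <-cmp j j′
    ... | tri≈ _ eq _ = eq
    ... | tri< j< _ _ = contradiction χ-same (survivor-least j′ s′ alive′ j j<)
    ... | tri> _ _ j> = contradiction (≃-sym {λ t → χ t j} {λ t → χ t j′} χ-same)
      (survivor-least j s alive j′ j>)
  ... | refl = refl , trans (sym (alive (s ⊔ s′) (m≤m⊔n s s′))) (alive′ (s ⊔ s′) (m≤n⊔m s s′))

  related : ∀ I J → V I ≃ V J → Related I J
  related I J same with classify I | classify J
  ... | isFinished {t = t} fin | isFinished {t = u} fin′ = bothFinished {t = t} {u} fin fin′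
  ... | isFinished {t = t} fin | isToken {x} {m} m≤ = ⊥-elim (finished-not-token I x m {t} fin m≤ same)
  ... | isToken {x} {m} m≤ | isFinished {t = t} fin = ⊥-elim (finished-not-token J x m {t} fin m≤ (≃-sym {V I} {V J} same))
  ... | isFinished {t = t} {N} fin | isWorker {j} {s} alive = ⊥-elim (worker-not-OddSegment j s alive N
    (OddSegment-resp-≃ {n = N} same (finished-OddSegment I {t} fin)))
  ... | isWorker {j} {s} alive | isFinished {t = t} {N} fin = ⊥-elim (worker-not-OddSegment j s alive N
    (OddSegment-resp-≃ {n = N} (≃-sym {V I} {V J} same) (finished-OddSegment J {t} fin)))
  ... | isToken {x} {m} m≤ | isWorker {j} {s} alive with n , segment ← token-OddSegment x m m≤ =
    ⊥-elim (worker-not-OddSegment j s alive n (OddSegment-resp-≃ {n = n} same segment))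
  ... | isWorker {j} {s} alive | isToken {x} {m} m≤ with n , segment ← token-OddSegment x m m≤ =
    ⊥-elim (worker-not-OddSegment j s alive n (OddSegment-resp-≃ {n = n} (≃-sym {V I} {V J} same) segment))
  ... | isWorker {j} {s} alive | isWorker alive′ with refl , refl ← worker-unique alive alive′ same = sameWorker
  related (token x m) (token x′ m′) same | isToken m≤ | isToken m′≤
    with T , settled ← group-settles x | T′ , settled′ ← group-settles x′
    with refl ← proj₂ (Equivalence.to (tokenFunction x′ m′ m′≤ (settled′ m′ m′≤) refl 0 (suc x))
      (Equivalence.to (same 0 (suc x))
        (Equivalence.from (tokenFunction x m m≤ (settled m m≤) refl 0 (suc x)) (z≤n , refl)))) =
    sameGroup m≤ m′≤

  -- Equal functions force equal final positions, from which the common block cancels. Agreement at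
  -- all late stages allows waiting until a given range has been entered.
  token-same-state : ∀ x m m′ → m ≤ 2 ^ x → m′ ≤ 2 ^ x → V (token x m) ≃ V (token x m′) →
                     ∃[ T ] (∀ t → T ≤ t → tokenState t x m ≡ tokenState t x m′)
  token-same-state x m m′ m≤ m′≤ same with T , settled ← group-settles x =
    T , λ t T≤t → +-cancelˡ-≡ (lastChange t x * 2 ^ x) _ _
      (trans (settled m m≤ t T≤t) (trans (OddSegment-unique
        (OddSegment-resp-≃ {n = position T x m} same
          (tokenFunction-OddSegment x m m≤ (settled m m≤) refl))
        (tokenFunction-OddSegment x m′ m′≤ (settled m′ m′≤) refl))
        (sym (settled m′ m′≤ t T≤t))))

  twins : ∀ x → ∃[ m ] ∃[ m′ ] m ≤ 2 ^ x × m′ ≤ 2 ^ x × m ≢ m′ × V (token x m) ≃ V (token x m′)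
  twins x with T , settled ← group-settles x
    with a , b , a<b , same ← pigeonhole {m = 2 ^ x} (n<1+n (2 ^ x))
      (λ i → fromℕ< (state< x T (tokenCode x (toℕ i)))) =
    toℕ a , toℕ b , a≤ , b≤ , <⇒≢ a<b ,
    λ y v → mk⇔
      (λ d → Equivalence.from (tokenFunction x (toℕ b) b≤ (settled (toℕ b) b≤) refl y v)
        (subst (λ n → y ≤ n + n × v ≡ suc x) positions
          (Equivalence.to (tokenFunction x (toℕ a) a≤ (settled (toℕ a) a≤) refl y v) d)))
      (λ d → Equivalence.from (tokenFunction x (toℕ a) a≤ (settled (toℕ a) a≤) refl y v)
        (subst (λ n → y ≤ n + n × v ≡ suc x) (sym positions)
          (Equivalence.to (tokenFunction x (toℕ b) b≤ (settled (toℕ b) b≤) refl y v) d)))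
    where
    a≤ : toℕ a ≤ 2 ^ x
    a≤ = ≤-pred (toℕ<n a)
    b≤ : toℕ b ≤ 2 ^ x
    b≤ = ≤-pred (toℕ<n b)
    positions : position T x (toℕ a) ≡ position T x (toℕ b)
    positions = cong (lastChange T x * 2 ^ x +_)
      (fromℕ<-injective _ _ (state< x T _) (state< x T _) same)

  -- Universality

  first≡0 : ∀ a {b} c → b ≡ 0 → a * (b * c) ≡ 0
  first≡0 a c refl = *-zeroʳ a

  second≡0 : ∀ a b {c} → c ≡ 0 → a * (b * c) ≡ 0
  second≡0 a b refl = trans (cong (a *_) (*-zeroʳ b)) (*-zeroʳ a)

  -- If the last value is nonzero and the function is constant, vacancy remains: a token of the
  -- group standing at `n` would compute `φ i`.
  valid-witness : ∀ i t₀ n → OddSegment (λ t → φ t i) n → (∀ y → y ≤ n + n → φ t₀ i y ≢ 0) →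
                  (∀ x m → m ≤ 2 ^ x → ¬ (V (token x m) ≃ (λ t → φ t i))) →
                  ∃[ w ] invalid i t₀ n w ≡ 0
  valid-witness i t₀ n segment all↓ no-token with pred (φ t₀ i (n + n)) in last
  ... | zero = 0 , refl
  ... | suc x with em {∃[ w ] w ≤ n + n × pred (φ t₀ i w) ≢ suc x}
  ... | yes (w , w≤ , differs) = w , first≡0 (suc x) _
    (cong₂ _+_ (m≤n⇒m∸n≡0 w≤) (≢0⇒neg≡0 (≢⇒∣-∣≢0 differs)))
  ... | no constant with T , settled ← group-settles x =
    w , second≡0 (suc x) ((w ∸ (n + n)) + neg ∣ pred (φ t₀ i w) - suc x ∣) (cong₂ _+_ (m≤n⇒m∸n≡0 (m≤n⊔m T n)) vacant)
    where
    w : ℕ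
    -- Late enough for the group to have settled, and at least `n`, as the certificate demands.
    w = T ⊔ n
    value-x : ∀ y → y ≤ n + n → φ t₀ i y ≡ suc (suc x)
    value-x y y≤ with pred (φ t₀ i y) ≟ suc x
    ... | yes eq = trans (≢0⇒≡suc (all↓ y y≤)) (cong suc eq)
    ... | no  ≢  = contradiction (y , y≤ , ≢) constant
    vacant : occupied (suc (2 ^ x)) n w x ≡ 0
    vacant = zero-∑ (suc (2 ^ x)) λ m m< → ≢0⇒neg≡0 (≢⇒∣-∣≢0 λ at-n →
      no-token x m (≤-pred m<) λ y v →
        let token⇔ = tokenFunction x m (≤-pred m<)
              (Settled-later (m≤m⊔n T n) (settled m (≤-pred m<))) at-n y v in mk⇔
        (λ d → case Equivalence.to token⇔ d of λ { (y≤ , refl) → t₀ , value-x y y≤ })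
        (λ d → let y≤ = Equivalence.to (segment y) (v , d) in
          Equivalence.from token⇔ (y≤ , ↓-functional (φ-persistent i y) d (t₀ , value-x y y≤))))

  V-universal : ∀ i → ∃[ I ] V I ≃ (λ t → φ t i)
  V-universal i with φ-cover i
  ... | inj₁ (j , same)
    with k , least , same′ ← least-index j
    with s , T , alive ← guess-converges k least =
    worker k s , ≃-trans {V (worker k s)} {λ t → χ t k} {λ t → φ t i} (worker-≃ T alive)
      (≃-trans {λ t → χ t k} {λ t → χ t j} {λ t → φ t i} same′ same)
  ... | inj₂ (n , segment) with em {∃[ x ] ∃[ m ] m ≤ 2 ^ x × V (token x m) ≃ (λ t → φ t i)}
  ... | yes (x , m , _ , same) = token x m , same
  ... | no  no-token
    with t₀ , all↓ ← bounded-choice (suc (n + n)) (λ y t → φ t i y ≢ 0)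
      (λ {y} b≤c ≢0 → ≡suc⇒≢0 (persists (φ-persistent i y) b≤c (≢0⇒≡suc ≢0)))
      (λ y y< → case Equivalence.from (segment y) (≤-pred y<) of λ
        { (v , t , eq) → t , ≡suc⇒≢0 eq })
    with w , valid ← valid-witness i t₀ n segment (λ y y≤ → all↓ y (s≤s y≤))
      (λ x m m≤ same → no-token (x , m , m≤ , same)) =
    canonical i t₀ n w , λ y v → mk⇔
      (λ { (t , eq) → case ifz-≡suc {y ∸ (n + n)} (trans (sym (value≡ t y)) eq) of λ
        { (y≤ , eq′) → t₀ , trans (≢0⇒≡suc (all↓ y (s≤s (m∸n≡0⇒m≤n y≤)))) eq′ } })
      (λ d → let y≤ = Equivalence.to (segment y) (v , d)
                 v≡ = ↓-functional (φ-persistent i y) (t₀ , ≢0⇒≡suc (all↓ y (s≤s y≤))) d in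
        t₀ , trans (value≡ t₀ y) (trans (ifz-yes (m≤n⇒m∸n≡0 y≤)) (cong suc v≡)))
    where
    value≡ : ∀ t y → value t (canonical i t₀ n w) y ≡
                     ifz (y ∸ (n + n)) (suc (pred (φ t₀ i y))) 0
    value≡ t y = trans (value-finished {t} {canonical i t₀ n w} (ifz-yes valid))
      (cong (λ c → ifz (y ∸ (n + n)) (suc c) 0) (ifz-yes valid))

  -- The effective programming system

  Vᶜ : ℕ → ℕ → ℕ → ℕ
  Vᶜ p = V (decode p)

  Vᶜ-persistent : ∀ p → Persistent₂ (Vᶜ p)
  Vᶜ-persistent p = value-persistent (decode p)

  ψ-function : Vec ℕ 2 ⇀ ℕ
  ψ-function = limit {h = λ t p y → value t (decode p) y} λ { (p ∷ y ∷ []) → Vᶜ-persistent p y }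

  program-computable : ∀ p → PartialComputable (section ψ-function p)
  program-computable p = PartialComputable-resp-≐ {f = limit {h = stages} persistent} {section ψ-function p}
    (λ { (y ∷ []) v → mk⇔ id id })
    (limit-computable (explicit (valueCode-total · # 0F ∷ lit p ∷ # 1F ∷ []) λ { (_ ∷ _ ∷ []) → refl })
      persistent)
    where
    stages : ℕ → ℕ → ℕ
    stages t y = value t (decode p) y
    persistent : ∀ xs → Persistent (λ t → stages t $$ xs)
    persistent (y ∷ []) = Vᶜ-persistent p y

  opaque

    ψ : EPS
    ψ = record
      { function   = ψ-function
      ; computable = limit-computable valueCode-total λ { (p ∷ y ∷ []) → Vᶜ-persistent p y }
      ; universal  = universal
      }
      where
      universal : (ζ : Vec ℕ 1 ⇀ ℕ) → PartialComputable ζ → ∃[ p ] section ψ-function p ≐ ζ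
      universal ζ (c , ζ≐c) with I , same ← V-universal (encode c) =
        encodeIndex I , λ { (y ∷ []) v → mk⇔
          (λ d → Equivalence.from (ζ≐c (y ∷ []) v) (Equivalence.from (φ-universal c y v)
            (Equivalence.to (same y v) (subst (λ I → (λ t → value t I y) ↓ v) (decode-encodeIndex I) d))))
          (λ z → subst (λ I → (λ t → value t I y) ↓ v) (sym (decode-encodeIndex I))
            (Equivalence.from (same y v) (Equivalence.to (φ-universal c y v)
              (Equivalence.to (ζ≐c (y ∷ []) v) z)))) }

    ≃⇒≐ : ∀ {p q} → Vᶜ p ≃ Vᶜ q → program ψ p ≐ program ψ q
    ≃⇒≐ same (y ∷ []) v = same y v

    ≐⇒≃ : ∀ {p q} → program ψ p ≐ program ψ q → Vᶜ p ≃ Vᶜ q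
    ≐⇒≃ same y v = same (y ∷ []) v

    ψ-program-computable : ∀ p → PartialComputable (program ψ p)
    ψ-program-computable = program-computable

  -- The ceer `R`

  Finished : ℕ → Set
  Finished p = ∃[ t ] ∃[ N ] finished t (decode p) ≡ suc N

  -- Only finished indices are identified, since for these equality of
  -- programs has become decidable.
  R : Rel ℕ 0ℓ
  R p q = p ≡ q ⊎ (Finished p × Finished q × Vᶜ p ≃ Vᶜ q)

  R-isEquivalence : IsEquivalence R
  R-isEquivalence = record
    { refl  = inj₁ refl
    ; sym   = λ { (inj₁ eq) → inj₁ (sym eq)
                ; {p} {q} (inj₂ (fp , fq , same)) → inj₂ (fq , fp , ≃-sym {Vᶜ p} {Vᶜ q} same) }
    ; trans = λ { (inj₁ refl) qr → qr
                ; pq@(inj₂ _) (inj₁ refl) → pq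
                ; {p} {q} {r} (inj₂ (fp , _ , same)) (inj₂ (_ , fr , same′)) →
                    inj₂ (fp , fr , ≃-trans {Vᶜ p} {Vᶜ q} {Vᶜ r} same same′) }
    }

  R⇒Equiv : R ⇒ Equiv ψ
  R⇒Equiv {p} (inj₁ refl) = ≃⇒≐ {p} {p} (≃-refl {Vᶜ p})
  R⇒Equiv {p} {q} (inj₂ (_ , _ , same)) = ≃⇒≐ {p} {q} same

  finishedᶜ : ℕ → ℕ → ℕ
  finishedᶜ t p = finished t (decode p)

  disagreement : ℕ → ℕ → ℕ → ℕ → ℕ
  disagreement b t p q = ∑ b (λ y → ∣ value t (decode p) y - value t (decode q) y ∣)

  unverified : ℕ → ℕ → ℕ → ℕ
  unverified t p q = neg (finishedᶜ t p) + (neg (finishedᶜ t q) +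
    -- For the finished value N + 1 the bound is 2N + 2, which covers the domain {0, ..., 2N}.
    (∣ finishedᶜ t p - finishedᶜ t q ∣ + disagreement (finishedᶜ t p + finishedᶜ t p) t p q))

  test : ℕ → ℕ → ℕ → ℕ
  test t p q = ∣ p - q ∣ * unverified t p q

  test-total : Total 3 test
  test-total = explicit
    (*-total · (∣-∣-total · # 1F ∷ # 2F ∷ []) ∷
      (+-total · (neg-total · f ∷ []) ∷ (+-total · (neg-total · g ∷ []) ∷
        (+-total · (∣-∣-total · f ∷ g ∷ []) ∷
          (disagreement-total · (+-total · f ∷ f ∷ []) ∷ # 0F ∷ # 1F ∷ # 2F ∷ []) ∷ []) ∷ []) ∷ []) ∷ [])
    λ { (_ ∷ _ ∷ _ ∷ []) → refl }
    where
    f g : Term 3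
    f = finishedCode-total · # 0F ∷ # 1F ∷ []
    g = finishedCode-total · # 0F ∷ # 2F ∷ []
    disagreement-total : Total 4 disagreement
    disagreement-total = ∑-total {f = λ y t p q → ∣ value t (decode p) y - value t (decode q) y ∣}
      (explicit (∣-∣-total · (valueCode-total · # 1F ∷ # 2F ∷ # 0F ∷ []) ∷
                             (valueCode-total · # 1F ∷ # 3F ∷ # 0F ∷ []) ∷ [])
        λ { (_ ∷ _ ∷ _ ∷ _ ∷ []) → refl })

  finished-value : ∀ I {t N} → finished t I ≡ suc N → ∀ y v → (λ t → value t I y) ↓ v → value t I y ≡ suc v
  finished-value I {t} fin y v (u , eq) =
    trans (sym (proj₂ (finished-forever I (m≤n⊔m u t) fin) y))
          (persists (value-persistent I y) (m≤m⊔n u t) eq)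

  finished-≡ : ∀ I J {t M N} → finished t I ≡ suc M → finished t J ≡ suc N → V I ≃ V J →
               ∀ y → value t I y ≡ value t J y
  finished-≡ I J {t} fin fin′ same y with value t I y in eq | value t J y in eq′
  ... | zero  | zero  = refl
  ... | suc v | _     = trans (sym (finished-value J {t} fin′ y v (Equivalence.to (same y v) (t , eq)))) eq′
  ... | zero  | suc v = trans (sym eq) (finished-value I {t} fin y v (Equivalence.from (same y v) (t , eq′)))

  R⇔test : ∀ p q → R p q ⇔ (∃[ t ] test t p q ≡ 0)
  R⇔test p q = mk⇔ to from
    where
    to : R p q → ∃[ t ] test t p q ≡ 0
    to (inj₁ eq) = 0 , cong (_* unverified 0 p q) (m≡n⇒∣m-n∣≡0 eq)
    to (inj₂ ((t , M , fin) , (u , N , fin′) , same)) = T ,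
      trans (cong (∣ p - q ∣ *_) (cong₂ _+_ (≢0⇒neg≡0 (≡suc⇒≢0 finₚ))
        (cong₂ _+_ (≢0⇒neg≡0 (≡suc⇒≢0 fin-q)) (cong₂ _+_ (m≡n⇒∣m-n∣≡0 fin≡)
          (zero-∑ (finishedᶜ T p + finishedᶜ T p)
            λ y _ → m≡n⇒∣m-n∣≡0 (finished-≡ (decode p) (decode q) {T} finₚ fin-q same y))))))
        (*-zeroʳ ∣ p - q ∣)
      where
      T : ℕ
      T = t ⊔ u
      finₚ : finished T (decode p) ≡ suc M
      finₚ = proj₁ (finished-forever (decode p) (m≤m⊔n t u) fin)
      fin-q : finished T (decode q) ≡ suc N
      fin-q = proj₁ (finished-forever (decode q) (m≤n⊔m t u) fin′)
      fin≡ : finishedᶜ T p ≡ finishedᶜ T q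
      fin≡ = trans finₚ (trans (cong suc (OddSegment-unique
        (OddSegment-resp-≃ {n = M} same (finished-OddSegment (decode p) {T} finₚ))
        (finished-OddSegment (decode q) {T} fin-q))) (sym fin-q))
    from : ∃[ t ] test t p q ≡ 0 → R p q
    from (t , eq) with m*n≡0⇒m≡0∨n≡0 ∣ p - q ∣ eq
    ... | inj₁ dist≡0 = inj₁ (∣m-n∣≡0⇒m≡n dist≡0)
    ... | inj₂ rest = inj₂ ((t , _ , fin) , (t , _ , fin′) ,
      eventually-≃ (Vᶜ-persistent p) (Vᶜ-persistent q) t λ u t≤u y →
        trans (proj₂ (finished-forever (decode p) t≤u fin) y)
          (trans (agree y) (sym (proj₂ (finished-forever (decode q) t≤u fin′) y))))
      where
      N : ℕ
      N = pred (finishedᶜ t p)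
      rest′ = m+n≡0⇒n≡0 (neg (finishedᶜ t p)) rest
      rest″ = m+n≡0⇒n≡0 (neg (finishedᶜ t q)) rest′
      fin : finishedᶜ t p ≡ suc N
      fin = ≢0⇒≡suc (neg≡0⇒≢0 (m+n≡0⇒m≡0 (neg (finishedᶜ t p)) rest))
      fin′ : finishedᶜ t q ≡ suc N
      fin′ = trans (sym (∣m-n∣≡0⇒m≡n (m+n≡0⇒m≡0 ∣ finishedᶜ t p - finishedᶜ t q ∣ rest″))) fin
      2N< : ∀ {y} → y ≤ N + N → y < finishedᶜ t p + finishedᶜ t p
      2N< y≤ = subst (λ f → _ < f + f) (sym fin) (s≤s (≤-trans y≤ (+-monoʳ-≤ N (n≤1+n N))))
      agree : ∀ y → value t (decode p) y ≡ value t (decode q) y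
      agree y with y ≤? N + N
      ... | yes y≤ = ∣m-n∣≡0⇒m≡n (∑-zero (finishedᶜ t p + finishedᶜ t p)
        (m+n≡0⇒n≡0 ∣ finishedᶜ t p - finishedᶜ t q ∣ rest″) y (2N< y≤))
      ... | no  y≰ = trans (trans (value-finished {t} {decode p} fin) (ifz-no (m>n⇒m∸n≢0 (≰⇒> y≰))))
        (sym (trans (value-finished {t} {decode q} fin′) (ifz-no (m>n⇒m∸n≢0 (≰⇒> y≰)))))

  R-isCeer : IsCeer R
  R-isCeer = record { isEquivalence = R-isEquivalence ; isCE = IsCE-resp-⇔ R⇔test (domain-CE test-total) }

  data Relatedᶜ (p q : ℕ) : Set where
    tied   : R p q → Relatedᶜ p q
    tokens : ∀ {x m m′} → m ≤ 2 ^ x → m′ ≤ 2 ^ x → p ≡ tokenCode x m → q ≡ tokenCode x m′ →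
             Relatedᶜ p q

  -- Equalities missed by `R` are confined to single groups of tokens; both clauses of the theorem
  -- rest on this.
  relatedᶜ : ∀ p q → Vᶜ p ≃ Vᶜ q → Relatedᶜ p q
  relatedᶜ p q same = go refl refl (related (decode p) (decode q) same)
    where
    go : ∀ {I J} → decode p ≡ I → decode q ≡ J → Related I J → Relatedᶜ p q
    go p≡ q≡ (bothFinished {t = t} {u} fin fin′) = tied (inj₂
      ((t , _ , trans (cong (finished t) p≡) fin) , (u , _ , trans (cong (finished u) q≡) fin′) , same))
    go p≡ q≡ sameWorker =
      tied (inj₁ (trans (encodeIndex-decode-worker p p≡) (sym (encodeIndex-decode-worker q q≡))))
    go p≡ q≡ (sameGroup m≤ m′≤) =
      tokens m≤ m′≤ (encodeIndex-decode-token p p≡) (encodeIndex-decode-token q q≡)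

  -- Clause (a): weak ties

  module _ {t : ℕ → ℕ} (translation : t IsTranslationInto ψ) where

    private
      θ : EPS
      θ = proj₁ translation

      e : ℕ
      -- An index of `t` in `φ`, so the range of `t` is number `e` among those recorded by the
      -- states.
      e = encode (proj₁ (proj₁ (proj₂ translation)))

    range-index : ∀ r → (λ u → φ u e r) ↓ t r
    range-index r = Equivalence.to (φ-universal (proj₁ (proj₁ (proj₂ translation))) r (t r))
      (Equivalence.to (proj₂ (proj₁ (proj₂ translation)) (r ∷ []) (t r)) refl)

    φ-in-range : ∀ {u n p} → φ u e n ≡ suc p → t n ≡ p
    φ-in-range {u} {n} eq = ↓-functional (φ-persistent e n) (range-index n) (u , eq)

    translation-covers : ∀ p → ∃[ r ] Vᶜ p ≃ Vᶜ (t r)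
    translation-covers p with r , same ← EPS.universal θ (program ψ p) (ψ-program-computable p) =
      r , ≐⇒≃ {p} {t r} λ xs v → proj₂ (proj₂ translation) r xs v ⇔-∘ ⇔-sym (same xs v)

    members : ℕ → List ℕ
    members x = List.map (tokenCode x) (upTo (suc (2 ^ x)))

    exceptions : List ℕ
    exceptions = concatMap members (upTo (suc e))

    token∈exceptions : ∀ {x m} → x ≤ e → m ≤ 2 ^ x → tokenCode x m ∈ exceptions
    token∈exceptions {x} {m} x≤e m≤ = ∈-concatMap⁺ members
      (Any.map {P = x ≡_} {Q = λ y → tokenCode x m ∈ members y} (λ { refl → ∈-map⁺ (tokenCode x) (∈-upTo⁺ (s≤s m≤)) }) (∈-upTo⁺ (s≤s x≤e)))

    -- For `e < x` the state contains the digit of the range of `t`. The twins have equal states at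
    -- all late stages, so when one has been entered, so has the other.
    twin-hit : ∀ x m m′ r → e < x → m ≤ 2 ^ x → m′ ≤ 2 ^ x → V (token x m) ≃ V (token x m′) →
               t r ≡ tokenCode x m′ → range t (tokenCode x m)
    twin-hit x m m′ r e<x m≤ m′≤ same tr≡ =
      let T , same-state = token-same-state x m m′ m≤ m′≤ same
          U , r-defined  = range-index r
          n , _ , hit    = entered-elim (T ⊔ U) e (tokenCode x m) (≡suc⇒≢0 (trans
            (state-injective x (T ⊔ U) (tokenCode x m) (tokenCode x m′)
              (same-state (T ⊔ U) (m≤m⊔n T U)) e e<x)
            (entered-intro (T ⊔ U) e (tokenCode x m′) r (trans
              (persists (φ-persistent e r) (m≤n⊔m T U) r-defined) (cong suc tr≡)))))
      in n , φ-in-range hit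

    unhit-exceptional : ∀ p → ¬ (range t ≬ R p) → p ∈ exceptions
    unhit-exceptional p unhit = go (relatedᶜ p (t r) same)
      where
      r : ℕ
      r = proj₁ (translation-covers p)
      same : Vᶜ p ≃ Vᶜ (t r)
      same = proj₂ (translation-covers p)
      go : Relatedᶜ p (t r) → p ∈ exceptions
      go (tied Rpq) = ⊥-elim (unhit (t r , (r , refl) , Rpq))
      go (tokens {x} {m} {m′} m≤ m′≤ p≡ q≡) = case x ≤? e of λ
        { (yes x≤e) → subst (_∈ exceptions) (sym p≡) (token∈exceptions x≤e m≤)
        ; (no  x≰e) → ⊥-elim (unhit
            (p , subst (range t) (sym p≡) (twin-hit x m m′ r (≰⇒> x≰e) m≤ m′≤ same′ q≡) , inj₁ refl)) }
        where
        same′ : V (token x m) ≃ V (token x m′)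
        same′ = subst₂ (λ I J → V I ≃ V J)
          (trans (cong decode p≡) (decode-encodeIndex (token x m)))
          (trans (cong decode q≡) (decode-encodeIndex (token x m′))) same

    weakly-tied : WeaklyTies R t ψ
    weakly-tied = R⇒Equiv , exceptions , λ p unhit →
      Any.map {P = p ≡_} {Q = R p} inj₁ (unhit-exceptional p unhit)

  -- Clause (b): no ceer ties strongly

  equivalence-translation : ∀ {t} → Total 1 t → (∀ p → Equiv ψ p (t p)) → t IsTranslationInto ψ
  -- Replacing programs by equivalent ones does not change the numbering, so `ψ` itself is the
  -- translated system.
  equivalence-translation {t} T same = ψ , (code T , λ { (p ∷ []) v → mk⇔
    (λ { refl → correct T (p ∷ []) })
    (λ d → Eval-functional (code T) (p ∷ []) (correct T (p ∷ [])) d) }) , same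

  Equiv-refl : ∀ p → Equiv ψ p p
  Equiv-refl p xs v = mk⇔ id id

  token-≃ᶜ : ∀ x m m′ → V (token x m) ≃ V (token x m′) → Vᶜ (tokenCode x m) ≃ Vᶜ (tokenCode x m′)
  token-≃ᶜ x m m′ = subst₂ (λ I J → V I ≃ V J)
    (sym (decode-encodeIndex (token x m))) (sym (decode-encodeIndex (token x m′)))

  tokenCode-injective : ∀ {x m x′ m′} → tokenCode x m ≡ tokenCode x′ m′ → x ≡ x′ × m ≡ m′
  tokenCode-injective eq = ⟨,⟩-injective (proj₂ (⟨,⟩-injective eq))

  -- A genuine token never finishes, which leaves only equality in `R`: its class is a singleton.
  token-R : ∀ x m {q} → m ≤ 2 ^ x → R (tokenCode x m) q → tokenCode x m ≡ q
  token-R x m m≤ (inj₁ eq) = eq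
  token-R x m m≤ (inj₂ ((t , N , fin) , _)) = contradiction
    (trans (sym (token-live {t} {x} {m} m≤)) (trans (cong (finished t) (sym (decode-encodeIndex (token x m)))) fin)) λ ()

  Collapsed : Rel ℕ 0ℓ → ℕ → ℕ → ℕ → Set
  Collapsed R′ x m m′ = m ≤ 2 ^ x × m ≢ m′ × R′ (tokenCode x m) (tokenCode x m′)

  module _ {R′ : Rel ℕ 0ℓ} (ceer : IsCeer R′) (sound : R′ ⇒ Equiv ψ) where

    private
      f : Vec ℕ 2 ⇀ ℕ
      f = proj₁ (IsCeer.isCE ceer)

      e : ℕ
      e = encode (proj₁ (proj₁ (proj₂ (IsCeer.isCE ceer))))

    R′⇔run : ∀ p q → R′ p q ⇔ (∃[ k ] run k e ⟨ p , ⟨ q , 0 ⟩ ⟩ ≢ 0)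
    R′⇔run p q = mk⇔
      (λ { (v , d) → let k , eq = Equivalence.to (f⇔run v) d in k , ≡suc⇒≢0 eq })
      (λ { (k , ≢0) → pred (run k e ⟨ p , ⟨ q , 0 ⟩ ⟩) , Equivalence.from (f⇔run _) (k , ≢0⇒≡suc ≢0) })
      ⇔-∘ proj₂ (proj₂ (IsCeer.isCE ceer)) p q
      where
      f⇔run : ∀ v → graph f (p ∷ q ∷ []) v ⇔ (λ k → run k e ⟨ p , ⟨ q , 0 ⟩ ⟩) ↓ v
      f⇔run v = run-universal (proj₁ (proj₁ (proj₂ (IsCeer.isCE ceer)))) (p ∷ q ∷ []) v
        ⇔-∘ proj₂ (proj₁ (proj₂ (IsCeer.isCE ceer))) (p ∷ q ∷ []) v

    -- Since `R′` lies in `Equiv ψ`, anything it relates to the omitted twin is that twin or another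
    -- token of the group, and the latter would be a collapse. The twins need not be found
    -- effectively, as a single pair is built into the program.
    avoid-one : ∀ x → (∀ m m′ → ¬ Collapsed R′ x m m′) →
                Σ[ t ∈ (ℕ → ℕ) ] (t IsTranslationInto ψ × ¬ StronglyTies R′ t ψ)
    avoid-one x uncollapsed with m , m′ , m≤ , m′≤ , m≢m′ , same ← twins x =
      t , equivalence-translation t-total t-same , λ { (_ , hits) → missed (hits q) }
      where
      q q′ : ℕ
      q  = tokenCode x m
      q′ = tokenCode x m′
      t : ℕ → ℕ
      t p = ifz ∣ p - q ∣ q′ p
      t-total : Total 1 t
      t-total = explicit (ifz-total · (∣-∣-total · # 0F ∷ lit q ∷ []) ∷ lit q′ ∷ # 0F ∷ [])
        λ { (_ ∷ []) → refl }
      t-same : ∀ p → Equiv ψ p (t p)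
      t-same p = ifz-elim ∣ p - q ∣ (Equiv ψ p)
        (λ p≡q → subst (λ p → Equiv ψ p q′) (sym (∣m-n∣≡0⇒m≡n p≡q)) (≃⇒≐ {q} {q′} (token-≃ᶜ x m m′ same)))
        (λ _ → Equiv-refl p)
      t≢q : ∀ p → t p ≢ q
      t≢q p = ifz-elim ∣ p - q ∣ (_≢ q)
        (λ _ eq → m≢m′ (sym (proj₂ (tokenCode-injective eq)))) ∣-∣≢0⇒≢
      missed : ¬ (range t ≬ R′ q)
      missed (r , (n , tn≡r) , R′qr) with relatedᶜ q r (≐⇒≃ {q} {r} (sound R′qr))
      ... | tied Rqr = t≢q n (trans tn≡r (sym (token-R x m m≤ Rqr)))
      ... | tokens {m′ = m″} _ _ q≡ r≡ with refl , refl ← tokenCode-injective q≡ =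
        uncollapsed m m″ (m≤ , (λ { refl → t≢q n (trans tn≡r r≡) }) , subst (R′ q) r≡ R′qr)

    -- `z` codes two token numbers and a running time after which `R′` is seen to relate the tokens.
    -- A zero is a verified collapse, so minimisation chooses one effectively for each group.
    search : ℕ → ℕ → ℕ
    search z x = (π₁ z ∸ 2 ^ x) + (neg ∣ π₁ z - π₁ (π₂ z) ∣ +
      neg (run (π₂ (π₂ z)) e ⟨ tokenCode x (π₁ z) , ⟨ tokenCode x (π₁ (π₂ z)) , 0 ⟩ ⟩))

    search-total : Total 2 search
    search-total = explicit
      (+-total · (∸-total · a ∷ (2^-total · # 1F ∷ []) ∷ []) ∷
        (+-total · (neg-total · (∣-∣-total · a ∷ b ∷ []) ∷ []) ∷
          (neg-total · (run-total · (π₂-total · (π₂-total · # 0F ∷ []) ∷ []) ∷ lit e ∷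
            (⟨,⟩-total · (tokenCode-total · # 1F ∷ a ∷ []) ∷
              (⟨,⟩-total · (tokenCode-total · # 1F ∷ b ∷ []) ∷ lit 0 ∷ []) ∷ []) ∷ []) ∷ []) ∷ []) ∷ [])
      λ { (_ ∷ _ ∷ []) → refl }
      where
      a b : Term 2
      a = π₁-total · # 0F ∷ []
      b = π₁-total · (π₂-total · # 0F ∷ []) ∷ []

    search-sound : ∀ z x → search z x ≡ 0 → Collapsed R′ x (π₁ z) (π₁ (π₂ z))
    search-sound z x eq =
      m∸n≡0⇒m≤n (m+n≡0⇒m≡0 (π₁ z ∸ 2 ^ x) eq) ,
      ∣-∣≢0⇒≢ (neg≡0⇒≢0 (m+n≡0⇒m≡0 (neg ∣ π₁ z - π₁ (π₂ z) ∣) rest)) ,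
      Equivalence.from (R′⇔run _ _) (π₂ (π₂ z) , neg≡0⇒≢0 (m+n≡0⇒n≡0 (neg ∣ π₁ z - π₁ (π₂ z) ∣) rest))
      where
      rest = m+n≡0⇒n≡0 (π₁ z ∸ 2 ^ x) eq

    search-complete : ∀ x m m′ → Collapsed R′ x m m′ → ∃[ z ] search z x ≡ 0
    search-complete x m m′ (m≤ , m≢m′ , R′pq) with k , halts ← Equivalence.to (R′⇔run _ _) R′pq =
      ⟨ m , ⟨ m′ , k ⟩ ⟩ , found
      where
      found : search ⟨ m , ⟨ m′ , k ⟩ ⟩ x ≡ 0
      found rewrite π₁-⟨,⟩ m ⟨ m′ , k ⟩ | π₂-⟨,⟩ m ⟨ m′ , k ⟩ | π₁-⟨,⟩ m′ k | π₂-⟨,⟩ m′ k =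
        cong₂ _+_ (m≤n⇒m∸n≡0 m≤) (cong₂ _+_ (≢0⇒neg≡0 (≢⇒∣-∣≢0 m≢m′)) (≢0⇒neg≡0 halts))

    module _ (collapsed : ∀ x → ∃[ m ] ∃[ m′ ] Collapsed R′ x m m′) where

      least : ∀ x → ∃[ z ] search z x ≡ 0 × (∀ i → i < z → search i x ≢ 0)
      least x = μ-least (λ z → search z x)
        (search-complete x _ _ (proj₂ (proj₂ (collapsed x))))

      opaque

        choice : ℕ → ℕ
        choice x = proj₁ (least x)

        choice-total : Total 1 choice
        choice-total = minimisation search-total choice
          (λ { (x ∷ []) → proj₁ (proj₂ (least x)) }) (λ { (x ∷ []) → proj₂ (proj₂ (least x)) })

        chosen : ∀ x → Collapsed R′ x (π₁ (choice x)) (π₁ (π₂ (choice x)))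
        chosen x = search-sound (choice x) x (proj₁ (proj₂ (least x)))

      victim substitute : ℕ → ℕ
      victim x     = tokenCode x (π₁ (choice x))
      substitute x = tokenCode x (π₁ (π₂ (choice x)))

      group : ℕ → ℕ
      group p = π₁ (π₂ p)

      group-token : ∀ x m → group (tokenCode x m) ≡ x
      group-token x m = trans (cong π₁ (π₂-⟨,⟩ 0 ⟨ x , m ⟩)) (π₁-⟨,⟩ x m)

      -- If `p` codes no token, `group p` is meaningless, but then `p` is no victim and is kept.
      avoid : ℕ → ℕ
      avoid p = ifz ∣ p - victim (group p) ∣ (substitute (group p)) p

      avoid-total : Total 1 avoid
      avoid-total = explicit
        (ifz-total · (∣-∣-total · # 0F ∷ (tokenCode-total · x ∷ (π₁-total · z ∷ []) ∷ []) ∷ []) ∷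
          (tokenCode-total · x ∷ (π₁-total · (π₂-total · z ∷ []) ∷ []) ∷ []) ∷ # 0F ∷ [])
        λ { (_ ∷ []) → refl }
        where
        x z : Term 1
        x = π₁-total · (π₂-total · # 0F ∷ []) ∷ []
        z = choice-total · x ∷ []

      avoid-same : ∀ p → Equiv ψ p (avoid p)
      avoid-same p = ifz-elim ∣ p - victim (group p) ∣ (Equiv ψ p)
        (λ p≡ → subst (λ q → Equiv ψ q (substitute (group p))) (sym (∣m-n∣≡0⇒m≡n p≡))
          (sound (proj₂ (proj₂ (chosen (group p))))))
        (λ _ → Equiv-refl p)

      avoid≢victim : ∀ p x → avoid p ≢ victim x
      avoid≢victim p x = ifz-elim ∣ p - victim (group p) ∣ (_≢ victim x)
        (λ _ eq → substitute≢victim (proj₁ (tokenCode-injective eq)) eq)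
        (λ p≢ p≡ → ∣-∣≢0⇒≢ p≢ (trans p≡ (cong victim (sym (trans (cong group p≡) (group-token x _))))))
        where
        substitute≢victim : ∀ {x y} → x ≡ y → substitute x ≢ victim y
        substitute≢victim {x} refl eq = proj₁ (proj₂ (chosen x)) (sym (proj₂ (tokenCode-injective eq)))

      bound : List ℕ → ℕ
      bound = foldr (λ p b → group p ⊔ b) 0

      group≤bound : ∀ {p ps} → p ∈ ps → group p ≤ bound ps
      group≤bound (here refl) = m≤m⊔n _ _
      group≤bound {ps = p ∷ ps} (there p∈ps) = ≤-trans (group≤bound p∈ps) (m≤n⊔m (group p) _)

      never-everywhere-collapsed : ⊥
      never-everywhere-collapsed = 1+n≰n (subst (_≤ bound ps) (group-token x _)
        (group≤bound (Any.map (token-R x (π₁ (choice x)) v≤) (proj₂ (proj₂ tie) (victim x) missed))))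
        where
        tie : WeaklyTies R avoid ψ
        tie = weakly-tied (equivalence-translation avoid-total avoid-same)
        ps : List ℕ
        ps = proj₁ (proj₂ tie)
        x : ℕ
        -- A group beyond all listed exceptions: its victim is a singleton class of `R` missed by
        -- `avoid`, so it would have to be listed itself.
        x = suc (bound ps)
        v≤ : π₁ (choice x) ≤ 2 ^ x
        v≤ = proj₁ (chosen x)
        missed : ¬ (range avoid ≬ R (victim x))
        missed (r , (n , an≡r) , Rvr) =
          avoid≢victim n x (trans an≡r (sym (token-R x (π₁ (choice x)) v≤ Rvr)))

  not-strongly-tied : ∀ (R′ : Rel ℕ 0ℓ) → IsCeer R′ →
                      Σ[ t ∈ (ℕ → ℕ) ] (t IsTranslationInto ψ × ¬ StronglyTies R′ t ψ)
  not-strongly-tied R′ ceer with em {R′ ⇒ Equiv ψ}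
  -- If `R′` is not contained in `Equiv ψ`, condition (i) fails for every translation function, in
  -- particular for the identity.
  ... | no  unsound = id , equivalence-translation (explicit (# 0F) λ { (_ ∷ []) → refl }) Equiv-refl ,
    λ { (sound , _) → unsound sound }
  ... | yes sound with em {∃[ x ] (∀ m m′ → ¬ Collapsed R′ x m m′)}
  ...   | yes (x , uncollapsed) = avoid-one ceer sound x uncollapsed
  ...   | no  none = ⊥-elim (never-everywhere-collapsed ceer sound λ x →
    case em {∃[ m ] ∃[ m′ ] Collapsed R′ x m m′} of λ
      { (yes collapsed) → collapsed
      ; (no  not) → contradiction (x , λ m m′ c → not (m , m′ , c)) none })

theorem8 : ExcludedMiddle 0ℓ →
    Σ[ ψ ∈ EPS ] Σ[ R ∈ Rel ℕ 0ℓ ]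
    (IsCeer R × (R ⇒ Equiv ψ) ×
    (∀ (t : ℕ → ℕ) → t IsTranslationInto ψ → WeaklyTies R t ψ) ×
    (∀ (R' : Rel ℕ 0ℓ) → IsCeer R' →
    Σ[ t ∈ (ℕ → ℕ) ] (t IsTranslationInto ψ × ¬ StronglyTies R' t ψ)))
theorem8 em = ψ , R , R-isCeer , R⇒Equiv , (λ t → weakly-tied) , not-strongly-tied
  where open Construction em
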